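{- Let $d\ge 1$ be an integer and let $\mathcal{F}$ be the barycentric subdivision of $(d-1)$-dimensional simplicial complexes. Then its transformation matrix $H_{\mathcal{F}}$ (a $(d+1)\times(d+1)$ real matrix) is totally positive, i.e. all minors of all orders of $H_{\mathcal{F}}$ are non-negative.
   Context: Rows and columns of matrices are indexed starting from $0$. All simplicial complexes are finite. For a $(d-1)$-dimensional simplicial complex $\Delta$ with $f_{i-1}$ faces of dimension $i-1$ ($f_{ -1}=1$), the $h$-vector $h^\Delta=(h_0,\dots,h_d)$ is defined by $\sum_{i=0}^d h_i x^i=\sum_{i=0}^d f_{i-1}x^i(1-x)^{d-i}$. The barycentric subdivision of $\Delta$ is the simplicial complex of all chains in the poset of nonempty faces of $\Delta$ ordered by inclusion. Its transformation matrix $H_{\mathcal{F}}$ is the $(d+1)\times(d+1)$ matrix, depending only on $d$, such that $h^{\Delta'}=H_{\mathcal{F}}\,h^{\Delta}$ (column vectors) for every $(d-1)$-dimensional simplicial complex $\Delta$ with barycentric subdivision $\Delta'$. Explicitly (a known result of Brenti and Welker), $$H_{\mathcal F}=\left[\sum_{r=0}^{i} r^j (r+1)^{d-j}(-1)^{i-r}\binom{d+1}{i-r}\right]_{0\le i,j\le d},$$ with the convention $0^0=1$. -}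

module Defs where

open import Level using (0ℓ)
open import Data.Nat.Base as ℕ using (ℕ; zero; suc; _∸_)
open import Data.Nat.Properties as ℕₚ using ()
open import Data.Integer.Base as ℤ using (ℤ; +_; 0ℤ; 1ℤ; -1ℤ)
open import Data.Integer.Properties using (+-*-semiring)
open import Data.Fin.Base as Fin using (Fin; zero; suc; toℕ; punchIn)
open import Data.Fin.Properties using (all?)
open import Data.Fin.Subset using (Subset; inside; outside; _∈_; _⊆_; ∣_∣; ⊥; Nonempty)
open import Data.Fin.Subset.Properties using (_∈?_; _⊆?_; nonempty?; ⊆-trans; ∉⊥)
open import Data.List.Base using (List; []; _∷_; _++_; map; filter; length; lookup)
open import Data.Product.Base using (_×_; _,_; ∃)
open import Data.Sum.Base using (_⊎_)
open import Data.Vec.Base using ([]; _∷_)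
open import Data.Vec.Functional using (Vector)
open import Data.Empty using (⊥-elim)
open import Relation.Binary.Core using (_Preserves_⟶_)
open import Relation.Binary.PropositionalEquality using (_≡_)
open import Relation.Nullary.Decidable using (_→-dec_; _⊎-dec_)
open import Relation.Unary using (Pred; Decidable)
open import Algebra.Properties.Semiring.Sum +-*-semiring using (sum)

-- A finite simplicial complex whose vertices lie in Fin n.  A point of Fin n
-- need not itself be a face; such points contribute no faces.
record SimplicialComplex (n : ℕ) : Set₁ where
  field
    Face   : Pred (Subset n) 0ℓ
    Face?  : Decidable Face
    ∅-face : Face ⊥
    ⊆-face : ∀ {p q} → p ⊆ q → Face q → Face p

open SimplicialComplex public

allSubsets : ∀ n → List (Subset n)
allSubsets zero    = [] ∷ []
allSubsets (suc n) = map (outside ∷_) (allSubsets n) ++ map (inside ∷_) (allSubsets n)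

faces : ∀ {n} → SimplicialComplex n → List (Subset n)
faces Δ = filter (Face? Δ) (allSubsets _)

nonemptyFaces : ∀ {n} → SimplicialComplex n → List (Subset n)
nonemptyFaces Δ = filter nonempty? (faces Δ)

-- A face with k elements has dimension k - 1.
HasDimension : ∀ {n} → SimplicialComplex n → ℕ → Set
HasDimension Δ e =
  (∃ λ p → Face Δ p × ∣ p ∣ ≡ suc e) × (∀ p → Face Δ p → ∣ p ∣ ℕ.≤ suc e)

-- The vertex i of the subdivision stands for the i-th nonempty face of Δ, and
-- a set of vertices is a face when the corresponding faces of Δ form a chain.
barycentricSubdivision : ∀ {n} (Δ : SimplicialComplex n) →
                         SimplicialComplex (length (nonemptyFaces Δ))
barycentricSubdivision Δ = record
  { Face   = λ S → ∀ i → i ∈ S → ∀ j → j ∈ S → Comparable i j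
  ; Face?  = λ S → all? λ i → (i ∈? S) →-dec all? λ j → (j ∈? S) →-dec
                     ((face i ⊆? face j) ⊎-dec (face j ⊆? face i))
  ; ∅-face = λ i i∈⊥ → ⊥-elim (∉⊥ i∈⊥)
  ; ⊆-face = λ p⊆q chain i i∈p j j∈p → chain i (p⊆q i∈p) j (p⊆q j∈p)
  }
  where
  face : Fin (length (nonemptyFaces Δ)) → Subset _
  face = lookup (nonemptyFaces Δ)

  Comparable : (i j : Fin (length (nonemptyFaces Δ))) → Set
  Comparable i j = face i ⊆ face j ⊎ face j ⊆ face i

-- numFaces Δ i is f_{i-1}: the number of faces with i elements.
numFaces : ∀ {n} → SimplicialComplex n → ℕ → ℕ
numFaces Δ i = length (filter (λ p → ∣ p ∣ ℕₚ.≟ i) (faces Δ))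

-- Integer polynomials (all those used below have finite support), given by
-- their coefficient sequences.
Polynomial : Set
Polynomial = ℕ → ℤ

one : Polynomial
one zero    = 1ℤ
one (suc _) = 0ℤ

x·_ : Polynomial → Polynomial
(x· p) zero    = 0ℤ
(x· p) (suc k) = p k

[1-x]·_ : Polynomial → Polynomial
([1-x]· p) k = p k ℤ.- (x· p) k

x^_·_ : ℕ → Polynomial → Polynomial
x^ zero  · p = p
x^ suc i · p = x· (x^ i · p)

[1-x]^_ : ℕ → Polynomial
[1-x]^ zero  = one
[1-x]^ suc i = [1-x]· ([1-x]^ i)

-- The polynomial Σ_{0≤i≤d} f_{i-1} x^i (1-x)^(d-i), for Δ of dimension d - 1.
hPolynomial : ∀ {n} → ℕ → SimplicialComplex n → Polynomial
hPolynomial d Δ k =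
  sum {suc d} λ i → + numFaces Δ (toℕ i) ℤ.* (x^ toℕ i · ([1-x]^ (d ∸ toℕ i))) k

-- The h-vector (h_0, …, h_d) of a complex of dimension d - 1.
hVector : ∀ {n} (d : ℕ) → SimplicialComplex n → Vector ℤ (suc d)
hVector d Δ k = hPolynomial d Δ (toℕ k)

Matrix : ℕ → ℕ → Set
Matrix m n = Fin m → Fin n → ℤ

_*ᵥ_ : ∀ {m n} → Matrix m n → Vector ℤ n → Vector ℤ m
(M *ᵥ v) i = sum λ j → M i j ℤ.* v j

-- Laplace expansion along the first row.
det : ∀ {n} → Matrix n n → ℤ
det {zero}  M = 1ℤ
det {suc n} M =
  sum λ j → (-1ℤ ℤ.^ toℕ j) ℤ.* M zero j ℤ.* det (λ i k → M (suc i) (punchIn j k))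

TotallyPositive : ∀ {m n} → Matrix m n → Set
TotallyPositive {m} {n} M =
  ∀ k (r : Fin k → Fin m) (c : Fin k → Fin n) →
  r Preserves Fin._<_ ⟶ Fin._<_ → c Preserves Fin._<_ ⟶ Fin._<_ →
  0ℤ ℤ.≤ det (λ i j → M (r i) (c j))

-- For d ≥ 1.  The subdivision of a (d-1)-dimensional complex is again
-- (d-1)-dimensional, so the same d is used for both h-vectors.  The condition
-- determines H uniquely, even among real matrices: the h-vectors of
-- (d-1)-dimensional complexes span, and H has integer entries.
IsTransformationMatrix : (d : ℕ) → Matrix (suc d) (suc d) → Set₁
IsTransformationMatrix d H =
  ∀ {n} (Δ : SimplicialComplex n) → HasDimension Δ (d ∸ 1) →
  ∀ i → hVector d (barycentricSubdivision Δ) i ≡ (H *ᵥ hVector d Δ) i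

{-# OPTIONS --safe #-}

-- Write E for multiplication by (1-x)^(d+1), acting on sequences g : ℕ → ℤ
-- regarded as power series.
--
-- Counting multichains of faces gives Σ_i C(r,i) f_{i-1}(Δ') = Σ_i r^i f_{i-1}(Δ)
-- for the subdivision Δ' of Δ; applying E turns the left side into the h-vector
-- of Δ'.  For the unions of the first m+1 facets of the boundary of a d-simplex,
-- the h-vector of Δ is 1 + x + … + x^m, so consecutive m isolate the columns of
-- H: column j is E(r ↦ (r+1)^(d-j) r^j).
--
-- These polynomials in r and the polynomials (r+d-i)⋯(r-i+1), which E sends to
-- d! x^i, are the products of d consecutive factors r - t_k for the knots
-- -1,…,-1,0,…,0 and -d,…,-1,0,…,d-1 respectively.  Inserting the knots -1 and
-- 0 one at a time leads from the latter to the former, and each insertion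
-- replaces every product by a nonnegative combination of two neighbouring ones.
-- Expanding a minor multilinearly in its columns shows that such a step
-- preserves nonnegativity of minors: columns with repeated indices vanish.
module Submission where

open import Defs
open import Data.Nat.Base as ℕ using (ℕ; zero; suc; _≤_; z≤n; s≤s; _∸_; _!)
import Data.Nat.Properties as ℕₚ
open import Data.Nat.Combinatorics using (_C_; nCk+nC[k+1]≡[n+1]C[k+1])
open import Data.Integer.Base as ℤ using (ℤ; +_; 0ℤ; 1ℤ; -1ℤ; _+_; _*_; _-_)
import Data.Integer.Properties as ℤₚ
open import Data.Integer.Tactic.RingSolver using (solve-∀)
open import Algebra.Properties.AbelianGroup ℤₚ.+-0-abelianGroup using (∙-cancelˡ)
open import Algebra.Properties.Semiring.Sum ℤₚ.+-*-semiring using (sum; sum-cong-≗; sum-replicate-zero; ∑-distrib-+)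
open import Data.Bool.Base using (Bool; true; false; T; not; if_then_else_; _∧_)
open import Data.Bool.Properties using (∧-zeroʳ; T?; T-∧)
import Data.Empty as Empty
open import Data.Fin.Base as Fin using (Fin; zero; suc; toℕ; punchIn; punchOut)
import Data.Fin.Properties as Finₚ
open import Data.Fin.Subset using (Subset; inside; outside; _∈_; _⊆_; ∣_∣; ⊥; ⊤; Nonempty)
open import Data.Fin.Subset.Properties using (_∈?_; _⊆?_; _⊂?_; nonempty?; ⊆-refl; ⊆-trans; ⊥⊆; ∉⊥; p⊂q⇒∣p∣<∣q∣; ∣p∣≤n; ∣⊤∣≡n; drop-∷-⊆)
open import Data.List.Base using (List; []; _∷_; _++_; map; filter; length; lookup)
open import Data.List.Membership.Propositional using () renaming (_∈_ to _∈ₗ_)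
open import Data.List.Membership.Propositional.Properties using (∈-filter⁻)
open import Data.List.Relation.Unary.All as All using (All; []; _∷_)
import Data.List.Relation.Unary.All.Properties as Allₚ
open import Data.List.Relation.Unary.AllPairs as AllPairs using (AllPairs; []; _∷_)
import Data.List.Relation.Unary.AllPairs.Properties as AllPairsₚ
open import Data.List.Relation.Unary.Any using (here; there)
open import Data.Product.Base using (_×_; _,_; ∃; ∃₂; proj₁; proj₂)
open import Data.Sum.Base using (_⊎_; inj₁; inj₂; swap)
open import Data.Unit.Base as Unit using (tt)
open import Data.Vec.Base using ([]; _∷_; here; there)
open import Data.Vec.Functional using (Vector; updateAt)
open import Data.Vec.Functional.Properties using (updateAt-updates; updateAt-minimal)
open import Function.Base using (_∘_; const; id; case_of_; _⟨_⟩_)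
open import Function.Bundles using (mk⇔; Equivalence)
open import Relation.Binary.Definitions using (tri<; tri≈; tri>)
open import Relation.Binary.PropositionalEquality
open import Relation.Nullary using (Dec; does; yes; no; contradiction)
open import Relation.Nullary.Decidable using (dec-true; dec-false; decidable-stable; does-⇔; _⊎-dec_)

-- Determinants

sum-zero : ∀ {n} (f : Vector ℤ n) → (∀ i → f i ≡ 0ℤ) → sum f ≡ 0ℤ
sum-zero {n} f f≡0 = trans (sum-cong-≗ f≡0) (sum-replicate-zero n)

sum-linear : ∀ {n} (s a b : ℤ) (f g h : Vector ℤ n) →
             (∀ i → s * f i ≡ a * g i + b * h i) → s * sum f ≡ a * sum g + b * sum h
sum-linear {zero}  s a b f g h eq = lemma s a b
  where
  lemma : ∀ s a b → s * 0ℤ ≡ a * 0ℤ + b * 0ℤ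
  lemma = solve-∀
sum-linear {suc n} s a b f g h eq = begin
  s * (f zero + sum (f ∘ suc))                         ≡⟨ ℤₚ.*-distribˡ-+ s (f zero) (sum (f ∘ suc)) ⟩
  s * f zero + s * sum (f ∘ suc)                       ≡⟨ cong₂ _+_ (eq zero) (sum-linear s a b (f ∘ suc) (g ∘ suc) (h ∘ suc) (eq ∘ suc)) ⟩
  (a * g zero + b * h zero) +
    (a * sum (g ∘ suc) + b * sum (h ∘ suc))            ≡⟨ lemma a b (g zero) (h zero) (sum (g ∘ suc)) (sum (h ∘ suc)) ⟩
  a * sum g + b * sum h                                ∎
  where
  open ≡-Reasoning
  lemma : ∀ a b x y z w → (a * x + b * y) + (a * z + b * w) ≡ a * (x + z) + b * (y + w)
  lemma = solve-∀

minor : ∀ {n} → Matrix (suc n) (suc n) → Fin (suc n) → Matrix n n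
minor M j i k = M (suc i) (punchIn j k)

det-cong : ∀ {n} {M N : Matrix n n} → (∀ i j → M i j ≡ N i j) → det M ≡ det N
det-cong {zero}  M≡N = refl
det-cong {suc n} {M} {N} M≡N = sum-cong-≗ λ j →
  cong₂ (λ x y → (-1ℤ ℤ.^ toℕ j) * x * y) (M≡N zero j)
    (det-cong {n} {minor M j} {minor N j} λ i k → M≡N (suc i) (punchIn j k))

-- In the Laplace expansion the summand of column `p` meets the changed column only in its first-row
-- entry; every other summand meets it only inside its minor and is handled by recursion. The factor
-- `s` clears the denominators of rational weights.
det-linear : ∀ {n} (p : Fin n) (s a b : ℤ) (M U V : Matrix n n) →
             (∀ i j → j ≢ p → M i j ≡ U i j) → (∀ i j → j ≢ p → M i j ≡ V i j) →
             (∀ i → s * M i p ≡ a * U i p + b * V i p) →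
             s * det M ≡ a * det U + b * det V
det-linear {suc n} p s a b M U V M≡U M≡V Mp =
  sum-linear s a b (term M) (term U) (term V) linear
  where
  term : Matrix (suc n) (suc n) → Fin (suc n) → ℤ
  term N j = (-1ℤ ℤ.^ toℕ j) * N zero j * det (minor N j)

  open ≡-Reasoning

  linear : ∀ j → s * term M j ≡ a * term U j + b * term V j
  linear j with j Finₚ.≟ p
  ... | yes refl = begin
    s * (σ * M zero j * D)                               ≡⟨ lemma₁ s σ (M zero j) D ⟩
    σ * (s * M zero j) * D                               ≡⟨ cong (λ z → σ * z * D) (Mp zero) ⟩
    σ * (a * U zero j + b * V zero j) * D                ≡⟨ lemma₂ σ a b (U zero j) (V zero j) D ⟩
    a * (σ * U zero j * D) + b * (σ * V zero j * D)      ≡⟨ cong₂ (λ x y → a * (σ * U zero j * x) + b * (σ * V zero j * y))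
                                                              (det-cong λ i k → M≡U (suc i) (punchIn j k) (Finₚ.punchInᵢ≢i j k))
                                                              (det-cong λ i k → M≡V (suc i) (punchIn j k) (Finₚ.punchInᵢ≢i j k)) ⟩
    a * term U j + b * term V j                          ∎
    where
    σ = -1ℤ ℤ.^ toℕ j
    D = det (minor M j)
    lemma₁ : ∀ s σ m D → s * (σ * m * D) ≡ σ * (s * m) * D
    lemma₁ = solve-∀
    lemma₂ : ∀ σ a b u v D → σ * (a * u + b * v) * D ≡ a * (σ * u * D) + b * (σ * v * D)
    lemma₂ = solve-∀
  ... | no j≢p = begin
    s * (σ * M zero j * D)                               ≡⟨ lemma₁ s σ (M zero j) D ⟩
    σ * M zero j * (s * D)                               ≡⟨ cong (λ z → σ * M zero j * z) minors ⟩
    σ * M zero j * (a * det (minor U j) + b * det (minor V j))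
                                                         ≡⟨ lemma₂ σ a b (M zero j) (det (minor U j)) (det (minor V j)) ⟩
    a * (σ * M zero j * det (minor U j)) + b * (σ * M zero j * det (minor V j))
                                                         ≡⟨ cong₂ (λ x y → a * (σ * x * det (minor U j)) + b * (σ * y * det (minor V j)))
                                                              (M≡U zero j j≢p) (M≡V zero j j≢p) ⟩
    a * term U j + b * term V j                          ∎
    where
    σ = -1ℤ ℤ.^ toℕ j
    D = det (minor M j)
    lemma₁ : ∀ s σ m D → s * (σ * m * D) ≡ σ * m * (s * D)
    lemma₁ = solve-∀
    lemma₂ : ∀ σ a b m u v → σ * m * (a * u + b * v) ≡ a * (σ * m * u) + b * (σ * m * v)
    lemma₂ = solve-∀
    -- Inside the minor, column `p` has the index `punchOut j≢p`.
    away : ∀ {k} → k ≢ punchOut j≢p → punchIn j k ≢ p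
    away k≢ jk≡p = k≢ (Finₚ.punchIn-injective j _ _ (trans jk≡p (sym (Finₚ.punchIn-punchOut j≢p))))
    minors : s * D ≡ a * det (minor U j) + b * det (minor V j)
    minors = det-linear (punchOut j≢p) s a b (minor M j) (minor U j) (minor V j)
      (λ i k k≢ → M≡U (suc i) (punchIn j k) (away k≢))
      (λ i k k≢ → M≡V (suc i) (punchIn j k) (away k≢))
      (λ i → subst (λ q → s * M (suc i) q ≡ a * U (suc i) q + b * V (suc i) q)
               (sym (Finₚ.punchIn-punchOut j≢p)) (Mp (suc i)))

det-zero-column : ∀ {n} (p : Fin n) (M : Matrix n n) → (∀ i → M i p ≡ 0ℤ) → det M ≡ 0ℤ
det-zero-column p M Mp≡0 = trans (sym (ℤₚ.*-identityˡ (det M)))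
  (det-linear p 1ℤ 0ℤ 0ℤ M M M (λ _ _ _ → refl) (λ _ _ _ → refl) (λ i → cong (1ℤ *_) (Mp≡0 i)))

-- An inductive form of b = a + 1 that recurses in step with `sum` and `punchIn`.
data Adjacent : ∀ {n} → Fin n → Fin n → Set where
  here  : ∀ {n} → Adjacent {suc (suc n)} zero (suc zero)
  there : ∀ {n} {a b : Fin n} → Adjacent a b → Adjacent (suc a) (suc b)

sum-adjacent : ∀ {n} {a b : Fin n} → Adjacent a b → (f : Vector ℤ n) →
               (∀ j → j ≢ a → j ≢ b → f j ≡ 0ℤ) → f a + f b ≡ 0ℤ → sum f ≡ 0ℤ
sum-adjacent here f others pair = begin
  f zero + (f (suc zero) + sum (λ j → f (suc (suc j)))) ≡⟨ ℤₚ.+-assoc (f zero) _ _ ⟨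
  f zero + f (suc zero) + sum (λ j → f (suc (suc j)))   ≡⟨ cong₂ _+_ pair (sum-zero _ λ j → others (suc (suc j)) (λ ()) (λ ())) ⟩
  0ℤ                                                   ∎
  where open ≡-Reasoning
sum-adjacent (there adj) f others pair =
  cong₂ _+_ (others zero (λ ()) (λ ()))
    (sum-adjacent adj (f ∘ suc)
      (λ j j≢a j≢b → others (suc j) (j≢a ∘ Finₚ.suc-injective) (j≢b ∘ Finₚ.suc-injective)) pair)

adjacent-toℕ : ∀ {n} {a b : Fin n} → Adjacent a b → toℕ b ≡ suc (toℕ a)
adjacent-toℕ here        = refl
adjacent-toℕ (there adj) = cong suc (adjacent-toℕ adj)

adjacent-punchIn : ∀ {n} {a b : Fin (suc n)} → Adjacent a b → ∀ k →
                   punchIn a k ≡ punchIn b k ⊎ (punchIn a k ≡ b × punchIn b k ≡ a)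
adjacent-punchIn here        zero    = inj₂ (refl , refl)
adjacent-punchIn here        (suc k) = inj₁ refl
adjacent-punchIn (there adj) zero    = inj₁ refl
adjacent-punchIn (there adj) (suc k) with adjacent-punchIn adj k
... | inj₁ eq        = inj₁ (cong suc eq)
... | inj₂ (eq , eq′) = inj₂ (cong suc eq , cong suc eq′)

-- A third index lies on one side of both `a` and `b`, so deleting it shifts them by the same
-- amount.
adjacent-punchOut : ∀ {n} {a b : Fin (suc n)} → Adjacent a b → ∀ j → j ≢ a → j ≢ b →
                    ∃₂ λ a′ b′ → Adjacent a′ b′ × punchIn j a′ ≡ a × punchIn j b′ ≡ b
adjacent-punchOut here zero          j≢a j≢b = contradiction refl j≢a
adjacent-punchOut here (suc zero)    j≢a j≢b = contradiction refl j≢b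
adjacent-punchOut {suc (suc n)} here (suc (suc j)) j≢a j≢b = zero , suc zero , here , refl , refl
adjacent-punchOut (there adj) zero    j≢a j≢b = _ , _ , adj , refl , refl
adjacent-punchOut {suc n} (there adj) (suc j) j≢a j≢b
  with adjacent-punchOut adj j (j≢a ∘ cong suc) (j≢b ∘ cong suc)
... | a′ , b′ , adj′ , eq , eq′ = suc a′ , suc b′ , there adj′ , cong suc eq , cong suc eq′

-- Minors at other columns still contain the equal pair and vanish by recursion. The minors at `a`
-- and `b` coincide and carry opposite signs, so their two summands cancel.
det-equal-columns : ∀ {n} {a b : Fin n} → Adjacent a b → (M : Matrix n n) →
                    (∀ i → M i a ≡ M i b) → det M ≡ 0ℤ
det-equal-columns {suc n} {a} {b} adj M Ma≡Mb = sum-adjacent adj _ others pair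
  where
  others : ∀ j → j ≢ a → j ≢ b → (-1ℤ ℤ.^ toℕ j) * M zero j * det (minor M j) ≡ 0ℤ
  others j j≢a j≢b with adjacent-punchOut adj j j≢a j≢b
  ... | a′ , b′ , adj′ , eq , eq′ =
    trans (cong ((-1ℤ ℤ.^ toℕ j) * M zero j *_) (det-equal-columns adj′ (minor M j) λ i →
             trans (cong (M (suc i)) eq) (trans (Ma≡Mb (suc i)) (sym (cong (M (suc i)) eq′)))))
          (ℤₚ.*-zeroʳ ((-1ℤ ℤ.^ toℕ j) * M zero j))

  minors : ∀ i k → minor M b i k ≡ minor M a i k
  minors i k with adjacent-punchIn adj k
  ... | inj₁ eq         = cong (M (suc i)) (sym eq)
  ... | inj₂ (eq , eq′) = trans (cong (M (suc i)) eq′) (trans (Ma≡Mb (suc i)) (sym (cong (M (suc i)) eq)))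

  cancel : ∀ σ m D → σ * m * D + (-1ℤ * σ) * m * D ≡ 0ℤ
  cancel = solve-∀

  pair : (-1ℤ ℤ.^ toℕ a) * M zero a * det (minor M a) + (-1ℤ ℤ.^ toℕ b) * M zero b * det (minor M b) ≡ 0ℤ
  pair rewrite adjacent-toℕ adj | sym (Ma≡Mb zero) | det-cong minors = cancel (-1ℤ ℤ.^ toℕ a) (M zero a) (det (minor M a))

-- Nonnegative determinants and nonnegative combinations of columns

StrictlyIncreasing WeaklyIncreasing : ∀ {k} → (Fin k → ℕ) → Set
StrictlyIncreasing x = ∀ {i j} → i Fin.< j → x i ℕ.< x j
WeaklyIncreasing   x = ∀ {i j} → i Fin.< j → x i ≤ x j

-- Equal values of a weakly increasing sequence fill consecutive positions, so comparing neighbours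
-- is enough. This is why `det-equal-columns` is only needed for adjacent columns.
repeat⊎strict : ∀ {k} (x : Fin k → ℕ) → WeaklyIncreasing x →
                (∃₂ λ a b → Adjacent a b × x a ≡ x b) ⊎ StrictlyIncreasing x
repeat⊎strict {zero}        x mono = inj₂ λ { {()} }
repeat⊎strict {suc zero}    x mono = inj₂ λ { {zero} {zero} () }
repeat⊎strict {suc (suc k)} x mono
  with ℕₚ.m≤n⇒m<n∨m≡n (mono {zero} {suc zero} (s≤s z≤n)) | repeat⊎strict {suc k} (x ∘ suc) (mono ∘ s≤s)
... | inj₂ x₀≡x₁ | _                        = inj₁ (zero , suc zero , here , x₀≡x₁)
... | inj₁ x₀<x₁ | inj₁ (a , b , adj , eq)  = inj₁ (suc a , suc b , there adj , eq)
... | inj₁ x₀<x₁ | inj₂ strict              = inj₂ increasing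
  where
  increasing : StrictlyIncreasing x
  increasing {zero}  {suc zero}    _         = x₀<x₁
  increasing {zero}  {suc (suc j)} _         = ℕₚ.<-trans x₀<x₁ (strict {zero} {suc j} (s≤s z≤n))
  increasing {suc i} {suc j}       (s≤s i<j) = strict i<j

nonneg-combination : ∀ {s a b x y z} → 0ℤ ℤ.< s → 0ℤ ℤ.≤ a → 0ℤ ℤ.≤ b → s * z ≡ a * x + b * y →
                     0ℤ ℤ.≤ x → 0ℤ ℤ.≤ y → 0ℤ ℤ.≤ z
nonneg-combination {s} {a} {b} {x} {y} {z} 0<s 0≤a 0≤b eq 0≤x 0≤y =
  ℤₚ.*-cancelˡ-≤-pos 0ℤ z s {{ℤ.positive 0<s}} (begin
    s * 0ℤ          ≡⟨ ℤₚ.*-zeroʳ s ⟩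
    0ℤ + 0ℤ         ≤⟨ ℤₚ.+-mono-≤ (nonneg-* 0≤a 0≤x) (nonneg-* 0≤b 0≤y) ⟩
    a * x + b * y   ≡⟨ eq ⟨
    s * z           ∎)
  where
  open ℤₚ.≤-Reasoning
  nonneg-* : ∀ {u v} → 0ℤ ℤ.≤ u → 0ℤ ℤ.≤ v → 0ℤ ℤ.≤ u * v
  nonneg-* {u} {v} 0≤u 0≤v =
    subst (ℤ._≤ u * v) (ℤₚ.*-zeroʳ u) (ℤₚ.*-monoˡ-≤-nonNeg u {{ℤ.nonNegative 0≤u}} 0≤v)

-- The weights are a/s and b/s; `s` keeps everything in ℤ. Two generators suffice because a knot
-- insertion mixes two neighbouring products. `A` is ℕ for whole sequences and `Fin k` for their
-- restrictions to the rows of a minor.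
record Cone {A : Set} (S : (A → ℤ) → Set) (v : A → ℤ) : Set where
  constructor cone
  field
    {s a b} : ℤ
    {u w}   : A → ℤ
    0<s     : 0ℤ ℤ.< s
    0≤a     : 0ℤ ℤ.≤ a
    0≤b     : 0ℤ ℤ.≤ b
    u∈S     : S u
    w∈S     : S w
    equal   : ∀ i → s * v i ≡ a * u i + b * w i

det-cone : ∀ {k} (S : Fin k → (Fin k → ℤ) → Set) →
           (∀ v → (∀ j → S j (v j)) → 0ℤ ℤ.≤ det (λ i j → v j i)) →
           ∀ v → (∀ j → Cone (S j) (v j)) → 0ℤ ℤ.≤ det (λ i j → v j i)
det-cone {k} S base v v∈cone = go k ℕₚ.≤-refl v (λ j _ → v∈cone j) (λ j k≤j → contradiction (Finₚ.toℕ<n j) (ℕₚ.≤⇒≯ k≤j))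
  where
  -- Columns before `p` still lie in their cones and those from `p` on are already generators; each
  -- round expands the last column still in a cone.
  go : ∀ p → p ≤ k → ∀ v → (∀ j → toℕ j ℕ.< p → Cone (S j) (v j)) → (∀ j → p ≤ toℕ j → S j (v j)) →
       0ℤ ℤ.≤ det (λ i j → v j i)
  go zero    _   v _     upper = base v (λ j → upper j z≤n)
  go (suc p) p<k v lower upper = nonneg-combination 0<s 0≤a 0≤b
      (det-linear P s a b _ _ _ (away u) (away w) at) (step u u∈S) (step w w∈S)
    where
    P : Fin k
    P = Fin.fromℕ< p<k
    toℕP : toℕ P ≡ p
    toℕP = Finₚ.toℕ-fromℕ< p<k
    open Cone (lower P (ℕₚ.≤-reflexive (cong suc toℕP)))
    set : (Fin k → ℤ) → Fin k → Fin k → ℤ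
    set x = updateAt v P (const x)
    away : ∀ x i j → j ≢ P → v j i ≡ set x j i
    away x i j j≢P = cong (λ f → f i) (sym (updateAt-minimal j P v j≢P))
    set-P : ∀ x → set x P ≡ x
    set-P x = updateAt-updates P v
    at : ∀ i → s * v P i ≡ a * set u P i + b * set w P i
    at i rewrite set-P u | set-P w = equal i
    step : ∀ x → S P x → 0ℤ ℤ.≤ det (λ i j → set x j i)
    step x x∈S = go p (ℕₚ.<⇒≤ p<k) (set x) lower′ upper′
      where
      lower′ : ∀ j → toℕ j ℕ.< p → Cone (S j) (set x j)
      lower′ j j<p = subst (Cone (S j)) (sym (updateAt-minimal j P v j≢P)) (lower j (ℕₚ.m<n⇒m<1+n j<p))
        where
        j≢P : j ≢ P
        j≢P refl = ℕₚ.<-irrefl toℕP j<p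
      upper′ : ∀ j → p ≤ toℕ j → S j (set x j)
      upper′ j p≤j with j Finₚ.≟ P
      ... | yes refl = subst (S P) (sym (set-P x)) x∈S
      ... | no  j≢P  = subst (S j) (sym (updateAt-minimal j P v j≢P))
                         (upper j (ℕₚ.≤∧≢⇒< p≤j λ p≡j → j≢P (Finₚ.toℕ-injective (trans (sym p≡j) (sym toℕP)))))

-- This covers the minors of a nonnegative diagonal matrix. If the first row and column indices
-- differ, the smaller one occurs on one side only, which gives a zero row or a zero column. If they
-- agree, one summand of the Laplace expansion survives.
det-diagonal : ∀ {k} (r c : Fin k → ℕ) → StrictlyIncreasing r → StrictlyIncreasing c → (M : Matrix k k) →
               (∀ i j → r i ≢ c j → M i j ≡ 0ℤ) → (∀ i j → 0ℤ ℤ.≤ M i j) → 0ℤ ℤ.≤ det M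
det-diagonal {zero}  r c r↑ c↑ M off nonneg = ℤ.+≤+ z≤n
det-diagonal {suc k} r c r↑ c↑ M off nonneg with ℕₚ.<-cmp (r zero) (c zero)
... | tri< r₀<c₀ _ _ = ℤₚ.≤-reflexive (sym (sum-zero _ λ j →
        trans (cong (λ m → (-1ℤ ℤ.^ toℕ j) * m * det (minor M j)) (off zero j (ℕₚ.<⇒≢ (r₀<c j))))
          (cong (_* det (minor M j)) (ℤₚ.*-zeroʳ (-1ℤ ℤ.^ toℕ j)))))
  where
  r₀<c : ∀ j → r zero ℕ.< c j
  r₀<c zero    = r₀<c₀
  r₀<c (suc j) = ℕₚ.<-trans r₀<c₀ (c↑ (s≤s z≤n))
... | tri> _ _ c₀<r₀ = ℤₚ.≤-reflexive (sym (det-zero-column zero M λ i → off i zero (ℕₚ.>⇒≢ (c₀<r i))))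
  where
  c₀<r : ∀ i → c zero ℕ.< r i
  c₀<r zero    = c₀<r₀
  c₀<r (suc i) = ℕₚ.<-trans c₀<r₀ (r↑ (s≤s z≤n))
-- With `s` = 1 and a zero second term, this says that a product of nonnegative numbers is
-- nonnegative.
... | tri≈ _ r₀≡c₀ _ = nonneg-combination {s = 1ℤ} {b = 0ℤ} {y = 0ℤ}
        (ℤ.+<+ (s≤s z≤n)) (nonneg zero zero) ℤₚ.≤-refl expansion
        (det-diagonal (r ∘ suc) (c ∘ suc) (r↑ ∘ s≤s) (c↑ ∘ s≤s) (minor M zero)
          (λ i j → off (suc i) (suc j)) (λ i j → nonneg (suc i) (suc j)))
        ℤₚ.≤-refl
  where
  term : Fin (suc k) → ℤ
  term j = (-1ℤ ℤ.^ toℕ j) * M zero j * det (minor M j)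
  tail : ∀ j → term (suc j) ≡ 0ℤ
  tail j = trans (cong (λ m → (-1ℤ ℤ.^ toℕ (suc j)) * m * det (minor M (suc j)))
                   (off zero (suc j) λ eq → ℕₚ.<⇒≢ (c↑ (s≤s z≤n)) (trans (sym r₀≡c₀) eq)))
             (cong (_* det (minor M (suc j))) (ℤₚ.*-zeroʳ (-1ℤ ℤ.^ toℕ (suc j))))
  lemma : ∀ m D → 1ℤ * (1ℤ * m * D + 0ℤ) ≡ m * D + 0ℤ * 0ℤ
  lemma = solve-∀
  expansion : 1ℤ * det M ≡ M zero zero * det (minor M zero) + 0ℤ * 0ℤ
  expansion = trans (cong (λ t → 1ℤ * (term zero + t)) (sum-zero (term ∘ suc) tail))
                (lemma (M zero zero) (det (minor M zero)))

-- Backward differences and knot insertion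

-- Multiplication of a power series by (1-x)^n, or the n-th backward difference of a sequence
-- continued by 0 to negative indices. The operator E is `∇^ (suc d)`.
∇^ : ℕ → Polynomial → Polynomial
∇^ zero    g = g
∇^ (suc n) g = [1-x]· ∇^ n g

∇-cong : ∀ {g h : Polynomial} → g ≗ h → [1-x]· g ≗ [1-x]· h
∇-cong g≗h zero    = cong (_- 0ℤ) (g≗h zero)
∇-cong g≗h (suc k) = cong₂ _-_ (g≗h (suc k)) (g≗h k)

∇^-cong : ∀ n {g h : Polynomial} → g ≗ h → ∇^ n g ≗ ∇^ n h
∇^-cong zero    g≗h = g≗h
∇^-cong (suc n) g≗h = ∇-cong (∇^-cong n g≗h)

∇^-linear : ∀ n s a b (g u w : Polynomial) → (∀ r → s * g r ≡ a * u r + b * w r) →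
            ∀ r → s * ∇^ n g r ≡ a * ∇^ n u r + b * ∇^ n w r
∇^-linear zero    s a b g u w eq r = eq r
∇^-linear (suc n) s a b g u w eq r = begin
  s * (∇^ n g r - (x· ∇^ n g) r)                               ≡⟨ lemma₁ s (∇^ n g r) ((x· ∇^ n g) r) ⟩
  s * ∇^ n g r - s * (x· ∇^ n g) r                             ≡⟨ cong₂ _-_ (∇^-linear n s a b g u w eq r) (shifted r) ⟩
  (a * ∇^ n u r + b * ∇^ n w r) - (a * (x· ∇^ n u) r + b * (x· ∇^ n w) r)
    ≡⟨ lemma₂ a b (∇^ n u r) (∇^ n w r) ((x· ∇^ n u) r) ((x· ∇^ n w) r) ⟩
  a * ∇^ (suc n) u r + b * ∇^ (suc n) w r                      ∎
  where
  open ≡-Reasoning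
  lemma₀ : ∀ s a b → s * 0ℤ ≡ a * 0ℤ + b * 0ℤ
  lemma₀ = solve-∀
  lemma₁ : ∀ s x y → s * (x - y) ≡ s * x - s * y
  lemma₁ = solve-∀
  lemma₂ : ∀ a b x y z t → (a * x + b * y) - (a * z + b * t) ≡ a * (x - z) + b * (y - t)
  lemma₂ = solve-∀
  shifted : ∀ r → s * (x· ∇^ n g) r ≡ a * (x· ∇^ n u) r + b * (x· ∇^ n w) r
  shifted zero    = lemma₀ s a b
  shifted (suc r) = ∇^-linear n s a b g u w eq r

∇^-scale : ∀ n a {g u : Polynomial} → (∀ r → g r ≡ a * u r) → ∀ r → ∇^ n g r ≡ a * ∇^ n u r
∇^-scale n a {g} {u} eq r = trans (sym (ℤₚ.*-identityˡ _))
  (trans (∇^-linear n 1ℤ a 0ℤ g u u (λ r → trans (ℤₚ.*-identityˡ _) (trans (eq r) (lemma a (u r)))) r)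
         (sym (lemma a (∇^ n u r))))
  where
  lemma : ∀ a x → a * x ≡ a * x + 0ℤ * x
  lemma = solve-∀

∇^-+ : ∀ n (g h : Polynomial) → ∇^ n (λ r → g r + h r) ≗ (λ r → ∇^ n g r + ∇^ n h r)
∇^-+ n g h r = trans (sym (ℤₚ.*-identityˡ _))
  (trans (∇^-linear n 1ℤ 1ℤ 1ℤ (λ r → g r + h r) g h (λ r → lemma (g r) (h r)) r)
         (trans (sym (lemma (∇^ n g r) (∇^ n h r))) (ℤₚ.*-identityˡ _)))
  where
  lemma : ∀ x y → 1ℤ * (x + y) ≡ 1ℤ * x + 1ℤ * y
  lemma = solve-∀

∇-x· : ∀ g → [1-x]· (x· g) ≗ x· ([1-x]· g)
∇-x· g zero    = refl
∇-x· g (suc r) = refl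

∇^-x· : ∀ n g → ∇^ n (x· g) ≗ x· (∇^ n g)
∇^-x· zero    g r = refl
∇^-x· (suc n) g r = trans (∇-cong (∇^-x· n g) r) (∇-x· (∇^ n g) r)

∇^-suc : ∀ n g → ∇^ (suc n) g ≗ ∇^ n ([1-x]· g)
∇^-suc zero    g = λ _ → refl
∇^-suc (suc n) g = ∇-cong (∇^-suc n g)

x·-cong : ∀ {g h} → g ≗ h → x· g ≗ x· h
x·-cong g≗h zero    = refl
x·-cong g≗h (suc r) = g≗h r

monomial-off : ∀ i r → r ≢ i → (x^ i · one) r ≡ 0ℤ
monomial-off zero    zero    r≢i = contradiction refl r≢i
monomial-off zero    (suc r) r≢i = refl
monomial-off (suc i) zero    r≢i = refl
monomial-off (suc i) (suc r) r≢i = monomial-off i r (r≢i ∘ cong suc)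

monomial-nonneg : ∀ i r → 0ℤ ℤ.≤ (x^ i · one) r
monomial-nonneg zero    zero    = ℤ.+≤+ z≤n
monomial-nonneg zero    (suc r) = ℤ.+≤+ z≤n
monomial-nonneg (suc i) zero    = ℤ.+≤+ z≤n
monomial-nonneg (suc i) (suc r) = monomial-nonneg i r

-- Products of linear factors and their differences

∏ : ℕ → (ℕ → ℤ) → ℤ
∏ zero    f = 1ℤ
∏ (suc n) f = f zero * ∏ n (f ∘ suc)

∏-cong : ∀ n {f g : ℕ → ℤ} → f ≗ g → ∏ n f ≡ ∏ n g
∏-cong zero    f≗g = refl
∏-cong (suc n) f≗g = cong₂ _*_ (f≗g zero) (∏-cong n (f≗g ∘ suc))

∏-last : ∀ n (f : ℕ → ℤ) → ∏ (suc n) f ≡ ∏ n f * f n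
∏-last zero    f = ℤₚ.*-comm (f zero) 1ℤ
∏-last (suc n) f = trans (cong (f zero *_) (∏-last n (f ∘ suc))) (sym (ℤₚ.*-assoc (f zero) (∏ n (f ∘ suc)) (f (suc n))))

-- After p insertions of -1 and q insertions of 0 the knots are -1 - (a ∸ p) and
-- b ∸ q; a ∸ p and b ∸ q are truncated, which piles up knots at -1 and 0.
lower upper : ℕ → ℤ → ℕ → ℤ
lower p t a = t + 1ℤ + + (a ∸ p)
upper q t b = t - + (b ∸ q)

-- For p = q = 0 this is (r+n)⋯(r-i+1), that is (n+i)! C(r+n, n+i). For p ≥ n and q ≥ i it is
-- (r+1)^n r^i.
window : (p q n i : ℕ) → Polynomial
window p q n i r = ∏ n (lower p (+ r)) * ∏ i (upper q (+ r))

-- With A = n ∸ p and B = i ∸ q, the factor r + 1 of the new window is the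
-- combination of r + 1 + A and r - B with weights B + 1 and A; dually r is the
-- combination with weights B and A + 1 in upper-step.
lower-step : ∀ p q n i r →
             (+ (n ∸ p) + + (i ∸ q) + 1ℤ) * window (suc p) q (suc n) i r ≡
             (+ (i ∸ q) + 1ℤ) * window p q (suc n) i r + + (n ∸ p) * window p q n (suc i) r
lower-step p q n i r
  rewrite ∏-last n (lower p (+ r)) | ∏-last i (upper q (+ r)) =
  lemma (+ (n ∸ p)) (+ (i ∸ q)) (∏ n (lower p (+ r))) (∏ i (upper q (+ r))) (+ r)
  where
  lemma : ∀ A B P Q t → (A + B + 1ℤ) * ((t + 1ℤ + 0ℤ) * P * Q) ≡
                        (B + 1ℤ) * (P * (t + 1ℤ + A) * Q) + A * (P * (Q * (t - B)))
  lemma = solve-∀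

upper-step : ∀ p q n i r →
             (+ (n ∸ p) + + (i ∸ q) + 1ℤ) * window p (suc q) n (suc i) r ≡
             (+ (n ∸ p) + 1ℤ) * window p q n (suc i) r + + (i ∸ q) * window p q (suc n) i r
upper-step p q n i r
  rewrite ∏-last n (lower p (+ r)) | ∏-last i (upper q (+ r)) =
  lemma (+ (n ∸ p)) (+ (i ∸ q)) (∏ n (lower p (+ r))) (∏ i (upper q (+ r))) (+ r)
  where
  lemma : ∀ A B P Q t → (A + B + 1ℤ) * (P * ((t - 0ℤ) * Q)) ≡
                        (A + 1ℤ) * (P * (Q * (t - B))) + B * (P * (t + 1ℤ + A) * Q)
  lemma = solve-∀

-- Substituting r + 1 moves the top factor of the upper product into the lower one. At r = 0 that
-- factor vanishes, which matches the 0 supplied by `x·`.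
window-x· : ∀ n i → window 0 0 n (suc i) ≗ x· (window 0 0 (suc n) i)
window-x· n i zero    = ℤₚ.*-zeroʳ (∏ n (lower 0 0ℤ))
window-x· n i (suc r) = begin
  ∏ n (lower 0 (+ suc r)) * ((+ suc r - 0ℤ) * ∏ i (upper 0 (+ suc r) ∘ suc))
    ≡⟨ cong₂ (λ P Q → P * ((+ suc r - 0ℤ) * Q)) (∏-cong n lowers) (∏-cong i uppers) ⟩
  P * ((1ℤ + + r - 0ℤ) * Q)
    ≡⟨ lemma P Q (+ r) ⟩
  (+ r + 1ℤ + 0ℤ) * P * Q ∎
  where
  open ≡-Reasoning
  P = ∏ n (lower 0 (+ r) ∘ suc)
  Q = ∏ i (upper 0 (+ r))
  lemma : ∀ P Q t → P * ((1ℤ + t - 0ℤ) * Q) ≡ (t + 1ℤ + 0ℤ) * P * Q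
  lemma = solve-∀
  lemma-l : ∀ t a → 1ℤ + t + 1ℤ + a ≡ t + 1ℤ + (1ℤ + a)
  lemma-l = solve-∀
  lowers : lower 0 (+ suc r) ≗ lower 0 (+ r) ∘ suc
  lowers a = lemma-l (+ r) (+ a)
  lemma-u : ∀ t a → 1ℤ + t - (1ℤ + a) ≡ t - a
  lemma-u = solve-∀
  uppers : upper 0 (+ suc r) ∘ suc ≗ upper 0 (+ r)
  uppers a = lemma-u (+ r) (+ a)

-- The difference rule for rising factorials. It also holds at r = 0, because (r+1)⋯(r+n+1) vanishes
-- at r = -1, in agreement with the continuation by 0.
∇-window : ∀ n r → ([1-x]· window 0 0 (suc n) 0) r ≡ + suc n * window 0 0 n 0 r
∇-window n zero = trans (cong (λ z → z * 1ℤ - 0ℤ) (∏-last n (lower 0 0ℤ))) (lemma (∏ n (lower 0 0ℤ)) (+ n))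
  where
  lemma : ∀ P n → P * (0ℤ + 1ℤ + n) * 1ℤ - 0ℤ ≡ (1ℤ + n) * (P * 1ℤ)
  lemma = solve-∀
∇-window n (suc r) = begin
  ∏ (suc n) (lower 0 (+ suc r)) * 1ℤ - (+ r + 1ℤ + 0ℤ) * ∏ n (lower 0 (+ r) ∘ suc) * 1ℤ
    ≡⟨ cong₂ (λ x y → x * 1ℤ - (+ r + 1ℤ + 0ℤ) * y * 1ℤ) (∏-last n (lower 0 (+ suc r))) (∏-cong n (λ a → sym (lemma-l (+ r) (+ a)))) ⟩
  P * (1ℤ + + r + 1ℤ + + n) * 1ℤ - (+ r + 1ℤ + 0ℤ) * P * 1ℤ
    ≡⟨ lemma P (+ r) (+ n) ⟩
  + suc n * (P * 1ℤ) ∎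
  where
  open ≡-Reasoning
  P = ∏ n (lower 0 (+ suc r))
  lemma-l : ∀ t a → 1ℤ + t + 1ℤ + a ≡ t + 1ℤ + (1ℤ + a)
  lemma-l = solve-∀
  lemma : ∀ P t n → P * (1ℤ + t + 1ℤ + n) * 1ℤ - (t + 1ℤ + 0ℤ) * P * 1ℤ ≡ (1ℤ + n) * (P * 1ℤ)
  lemma = solve-∀

[1-x]·1 : [1-x]· (λ _ → 1ℤ) ≗ one
[1-x]·1 zero    = refl
[1-x]·1 (suc r) = refl

-- The first n differences reduce the rising factorial to the constant n!, and the last one turns a
-- constant sequence into its value at index 0.
∇^-window₀ : ∀ n r → ∇^ (suc n) (window 0 0 n 0) r ≡ + (n !) * one r
∇^-window₀ zero    r = trans ([1-x]·1 r) (sym (ℤₚ.*-identityˡ (one r)))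
∇^-window₀ (suc n) r = begin
  ∇^ (suc (suc n)) (window 0 0 (suc n) 0) r        ≡⟨ ∇^-suc (suc n) (window 0 0 (suc n) 0) r ⟩
  ∇^ (suc n) ([1-x]· window 0 0 (suc n) 0) r       ≡⟨ ∇^-scale (suc n) (+ suc n) (∇-window n) r ⟩
  + suc n * ∇^ (suc n) (window 0 0 n 0) r          ≡⟨ cong (+ suc n *_) (∇^-window₀ n r) ⟩
  + suc n * (+ (n !) * one r)                      ≡⟨ ℤₚ.*-assoc (+ suc n) (+ (n !)) (one r) ⟨
  + suc n * + (n !) * one r                        ≡⟨ cong (_* one r) (ℤₚ.pos-* (suc n) (n !)) ⟨
  + (suc n !) * one r                              ∎
  where open ≡-Reasoning

∸-suc : ∀ {i d} → i ℕ.< d → suc (d ∸ suc i) ≡ d ∸ i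
∸-suc i<d = sym (ℕₚ.+-∸-assoc 1 i<d)

-- Raising i by one shifts the sequence by one place, and shifts commute with `∇^`. The initial
-- matrix is therefore d! times the identity.
∇^-window : ∀ d i → i ≤ d → ∀ r → ∇^ (suc d) (window 0 0 (d ∸ i) i) r ≡ + (d !) * (x^ i · one) r
∇^-window d zero    _   r = ∇^-window₀ d r
∇^-window d (suc i) i<d r = begin
  ∇^ (suc d) (window 0 0 (d ∸ suc i) (suc i)) r        ≡⟨ ∇^-cong (suc d) (window-x· (d ∸ suc i) i) r ⟩
  ∇^ (suc d) (x· window 0 0 (suc (d ∸ suc i)) i) r     ≡⟨ ∇^-x· (suc d) (window 0 0 (suc (d ∸ suc i)) i) r ⟩
  (x· ∇^ (suc d) (window 0 0 (suc (d ∸ suc i)) i)) r   ≡⟨ cong (λ n → (x· ∇^ (suc d) (window 0 0 n i)) r) (∸-suc i<d) ⟩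
  (x· ∇^ (suc d) (window 0 0 (d ∸ i) i)) r             ≡⟨ x·-cong (∇^-window d i (ℕₚ.<⇒≤ i<d)) r ⟩
  (x· (λ r → + (d !) * (x^ i · one) r)) r              ≡⟨ pull r ⟩
  + (d !) * (x^ suc i · one) r                         ∎
  where
  open ≡-Reasoning
  pull : ∀ r → (x· (λ r → + (d !) * (x^ i · one) r)) r ≡ + (d !) * (x^ suc i · one) r
  pull zero    = sym (ℤₚ.*-zeroʳ (+ (d !)))
  pull (suc r) = refl

-- Nonnegative minors along the knot insertions

NonnegativeMinors : ℕ → (ℕ → Polynomial) → Set
NonnegativeMinors d X = ∀ k (r c : Fin k → ℕ) → StrictlyIncreasing r → StrictlyIncreasing c →
                        (∀ j → c j ≤ d) → 0ℤ ℤ.≤ det (λ i j → X (c j) (r i))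

ColumnIn : ℕ → (ℕ → Polynomial) → (lo hi : ℕ) → Polynomial → Set
ColumnIn d X lo hi v = ∃ λ x → lo ≤ x × x ≤ hi × x ≤ d × v ≗ X x

-- Successive intervals from `lo` to `hi` share at most an endpoint, so expanding a minor of `Y`
-- leaves determinants of columns of `X` with weakly increasing indices. A repeated index gives 0;
-- otherwise the determinant is a minor of `X`.
minors-cone : ∀ d (X Y : ℕ → Polynomial) (lo hi : ℕ → ℕ) → (∀ {i j} → i ℕ.< j → hi i ≤ lo j) →
              (∀ i → i ≤ d → Cone (ColumnIn d X (lo i) (hi i)) (Y i)) →
              NonnegativeMinors d X → NonnegativeMinors d Y
minors-cone d X Y lo hi hi≤lo Y∈cone X≥0 k r c r↑ c↑ c≤d =
  det-cone S base (λ j i → Y (c j) (r i)) λ j → restrict (Y∈cone (c j) (c≤d j))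
  where
  S : Fin k → (Fin k → ℤ) → Set
  S j v = ∃ λ x → lo (c j) ≤ x × x ≤ hi (c j) × x ≤ d × v ≗ X x ∘ r

  restrict : ∀ {j v} → Cone (ColumnIn d X (lo (c j)) (hi (c j))) v → Cone (S j) (v ∘ r)
  restrict (cone 0<s 0≤a 0≤b (x , l , h , x≤d , u≗) (y , l′ , h′ , y≤d , w≗) eq) =
    cone 0<s 0≤a 0≤b (x , l , h , x≤d , u≗ ∘ r) (y , l′ , h′ , y≤d , w≗ ∘ r) (eq ∘ r)

  base : ∀ v → (∀ j → S j (v j)) → 0ℤ ℤ.≤ det (λ i j → v j i)
  base v v∈S with repeat⊎strict (λ j → proj₁ (v∈S j)) weak
    where
    weak : WeaklyIncreasing (λ j → proj₁ (v∈S j))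
    weak {i} {j} i<j with v∈S i | v∈S j
    ... | x , _ , x≤hi , _ | y , lo≤y , _ = ℕₚ.≤-trans x≤hi (ℕₚ.≤-trans (hi≤lo (c↑ i<j)) lo≤y)
  ... | inj₁ (a , b , adj , xa≡xb) = ℤₚ.≤-reflexive (sym (det-equal-columns adj _ λ i →
          trans (column a i) (trans (cong (λ x → X x (r i)) xa≡xb) (sym (column b i)))))
    where
    column : ∀ j i → v j i ≡ X (proj₁ (v∈S j)) (r i)
    column j = proj₂ (proj₂ (proj₂ (proj₂ (v∈S j))))
  ... | inj₂ strict = subst (0ℤ ℤ.≤_) (det-cong λ i j → sym (proj₂ (proj₂ (proj₂ (proj₂ (v∈S j)))) i))
          (X≥0 k r (λ j → proj₁ (v∈S j)) r↑ strict λ j → proj₁ (proj₂ (proj₂ (proj₂ (v∈S j)))))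

-- The matrix after `p` insertions of -1 and `q` insertions of 0, given by its columns.
stage : (d p q : ℕ) → ℕ → Polynomial
stage d p q i = ∇^ (suc d) (window p q (d ∸ i) i)

stage-start : ∀ d → NonnegativeMinors d (stage d 0 0)
stage-start d k r c r↑ c↑ c≤d = subst (0ℤ ℤ.≤_) (det-cong λ i j → sym (∇^-window d (c j) (c≤d j) (r i)))
  (det-diagonal r c r↑ c↑ _
    (λ i j r≢c → trans (cong (+ (d !) *_) (monomial-off (c j) (r i) r≢c)) (ℤₚ.*-zeroʳ (+ (d !))))
    (λ i j → subst (ℤ._≤ + (d !) * (x^ c j · one) (r i)) (ℤₚ.*-zeroʳ (+ (d !)))
               (ℤₚ.*-monoˡ-≤-nonNeg (+ (d !)) (monomial-nonneg (c j) (r i)))))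

trivial-cone : ∀ {S : Polynomial → Set} {u v} → S u → v ≗ u → Cone S v
trivial-cone {u = u} {v} u∈S v≗u =
  cone {s = 1ℤ} {a = 1ℤ} {b = 0ℤ} (ℤ.+<+ (s≤s z≤n)) (ℤ.+≤+ z≤n) (ℤ.+≤+ z≤n) u∈S u∈S λ i →
    trans (cong (1ℤ *_) (v≗u i)) (lemma (u i))
  where
  lemma : ∀ x → 1ℤ * x ≡ 1ℤ * x + 0ℤ * x
  lemma = solve-∀

0<+++1 : ∀ m n → 0ℤ ℤ.< + m + + n + 1ℤ
0<+++1 m n = ℤ.+<+ (ℕₚ.m≤n+m 1 (m ℕ.+ n))

-- By `lower-step`, column i mixes the old columns i and i + 1.
stage-lower : ∀ d p q → NonnegativeMinors d (stage d p q) → NonnegativeMinors d (stage d (suc p) q)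
stage-lower d p q = minors-cone d (stage d p q) (stage d (suc p) q) id suc id in-cone
  where
  in-cone : ∀ i → i ≤ d → Cone (ColumnIn d (stage d p q) i (suc i)) (stage d (suc p) q i)
  in-cone i i≤d with ℕₚ.m≤n⇒m<n∨m≡n i≤d
  -- The last column has no lower factors, so the insertion does not change it.
  ... | inj₂ refl = trivial-cone (i , ℕₚ.≤-refl , ℕₚ.n≤1+n i , ℕₚ.≤-refl , λ _ → refl)
          (∇^-cong (suc d) λ r → cong (λ n → ∏ n (lower (suc p) (+ r)) * ∏ i (upper q (+ r))) (ℕₚ.n∸n≡0 i)
            ⟨ trans ⟩ cong (λ n → ∏ n (lower p (+ r)) * ∏ i (upper q (+ r))) (sym (ℕₚ.n∸n≡0 i)))
  ... | inj₁ i<d = cone {s = + (n ∸ p) + + (i ∸ q) + 1ℤ} {a = + (i ∸ q) + 1ℤ} {b = + (n ∸ p)}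
      {u = stage d p q i} {w = stage d p q (suc i)}
      (0<+++1 (n ∸ p) (i ∸ q)) (ℤ.+≤+ z≤n) (ℤ.+≤+ z≤n)
      (i , ℕₚ.≤-refl , ℕₚ.n≤1+n i , i≤d , λ _ → refl)
      (suc i , ℕₚ.n≤1+n i , ℕₚ.≤-refl , i<d , λ _ → refl)
      (∇^-linear (suc d) (+ (n ∸ p) + + (i ∸ q) + 1ℤ) (+ (i ∸ q) + 1ℤ) (+ (n ∸ p))
         (window (suc p) q (d ∸ i) i) (window p q (d ∸ i) i) (window p q (d ∸ suc i) (suc i)) step)
    where
    n = d ∸ suc i
    step : ∀ r → (+ (n ∸ p) + + (i ∸ q) + 1ℤ) * window (suc p) q (d ∸ i) i r ≡
                 (+ (i ∸ q) + 1ℤ) * window p q (d ∸ i) i r + + (n ∸ p) * window p q n (suc i) r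
    step r rewrite sym (∸-suc i<d) = lower-step p q n i r

-- By `upper-step`, column i mixes the old columns i - 1 and i; column 0 has no upper factors and
-- stays as it is.
stage-upper : ∀ d p q → NonnegativeMinors d (stage d p q) → NonnegativeMinors d (stage d p (suc q))
stage-upper d p q = minors-cone d (stage d p q) (stage d p (suc q)) ℕ.pred id ℕₚ.<⇒≤pred in-cone
  where
  in-cone : ∀ i → i ≤ d → Cone (ColumnIn d (stage d p q) (ℕ.pred i) i) (stage d p (suc q) i)
  in-cone zero    _   = trivial-cone (zero , z≤n , z≤n , z≤n , λ _ → refl) λ _ → refl
  in-cone (suc i) i<d = cone {s = + (n ∸ p) + + (i ∸ q) + 1ℤ} {a = + (n ∸ p) + 1ℤ} {b = + (i ∸ q)}
      {u = stage d p q (suc i)} {w = stage d p q i}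
      (0<+++1 (n ∸ p) (i ∸ q)) (ℤ.+≤+ z≤n) (ℤ.+≤+ z≤n)
      (suc i , ℕₚ.n≤1+n i , ℕₚ.≤-refl , i<d , λ _ → refl)
      (i , ℕₚ.≤-refl , ℕₚ.n≤1+n i , ℕₚ.<⇒≤ i<d , λ _ → refl)
      (∇^-linear (suc d) (+ (n ∸ p) + + (i ∸ q) + 1ℤ) (+ (n ∸ p) + 1ℤ) (+ (i ∸ q))
         (window p (suc q) (d ∸ suc i) (suc i)) (window p q (d ∸ suc i) (suc i)) (window p q (d ∸ i) i) step)
    where
    n = d ∸ suc i
    step : ∀ r → (+ (n ∸ p) + + (i ∸ q) + 1ℤ) * window p (suc q) n (suc i) r ≡
                 (+ (n ∸ p) + 1ℤ) * window p q n (suc i) r + + (i ∸ q) * window p q (d ∸ i) i r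
    step r rewrite sym (∸-suc i<d) = upper-step p q n i r

stage-minors : ∀ d p q → NonnegativeMinors d (stage d p q)
stage-minors d zero    zero    = stage-start d
stage-minors d zero    (suc q) = stage-upper d zero q (stage-minors d zero q)
stage-minors d (suc p) q       = stage-lower d p q (stage-minors d p q)

∏-lower : ∀ {n p} → n ≤ p → ∀ t → ∏ n (lower p t) ≡ (t + 1ℤ) ℤ.^ n
∏-lower z≤n       t = refl
∏-lower (s≤s n≤p) t = cong₂ _*_ (ℤₚ.+-identityʳ (t + 1ℤ)) (∏-lower n≤p t)

∏-upper : ∀ {n q} → n ≤ q → ∀ t → ∏ n (upper q t) ≡ t ℤ.^ n
∏-upper z≤n       t = refl
∏-upper (s≤s n≤q) t = cong₂ _*_ (ℤₚ.+-identityʳ t) (∏-upper n≤q t)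

-- Its coefficient i is Σ_{r≤i} r^j (r+1)^(d-j) (-1)^(i-r) C(d+1, i-r), the closed form of the entry
-- (i, j) of H.
subdivisionColumn : ℕ → ℕ → Polynomial
subdivisionColumn d j = ∇^ (suc d) (λ r → (+ r + 1ℤ) ℤ.^ (d ∸ j) * (+ r) ℤ.^ j)

-- Column j has d - j lower and j upper factors, so `d` insertions of each kind move all its knots
-- to -1 and 0.
subdivisionColumn-minors : ∀ d → NonnegativeMinors d (subdivisionColumn d)
subdivisionColumn-minors d k r c r↑ c↑ c≤d =
  subst (0ℤ ℤ.≤_)
    (det-cong λ i j → ∇^-cong (suc d)
       (λ t → cong₂ _*_ (∏-lower (ℕₚ.m∸n≤m d (c j)) (+ t)) (∏-upper (c≤d j) (+ t))) (r i))
    (stage-minors d d d k r c r↑ c↑ c≤d)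

-- Sums over lists

private variable
  A B : Set
  n : ℕ

-- Indicator weights turn sums over filtered lists into sums over `allSubsets`, whose order can be
-- exchanged.
when : Bool → ℤ → ℤ
when b x = if b then x else 0ℤ

when-0 : ∀ b → when b 0ℤ ≡ 0ℤ
when-0 true  = refl
when-0 false = refl

when-+ : ∀ b x y → when b (x + y) ≡ when b x + when b y
when-+ true  x y = refl
when-+ false x y = refl

when-* : ∀ b x y → when b (x * y) ≡ x * when b y
when-* true  x y = refl
when-* false x y = sym (ℤₚ.*-zeroʳ x)

when-swap : ∀ a b x → when a (when b x) ≡ when b (when a x)
when-swap true  b x = refl
when-swap false b x = sym (when-0 b)

∑ : List A → (A → ℤ) → ℤ
∑ []       f = 0ℤ
∑ (x ∷ xs) f = f x + ∑ xs f

∑-cong-∈ : ∀ (xs : List A) {f g : A → ℤ} → (∀ {x} → x ∈ₗ xs → f x ≡ g x) → ∑ xs f ≡ ∑ xs g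
∑-cong-∈ []       f≗g = refl
∑-cong-∈ (x ∷ xs) f≗g = cong₂ _+_ (f≗g (here refl)) (∑-cong-∈ xs (f≗g ∘ there))

∑-cong : ∀ (xs : List A) {f g : A → ℤ} → f ≗ g → ∑ xs f ≡ ∑ xs g
∑-cong xs f≗g = ∑-cong-∈ xs λ {x} _ → f≗g x

∑-zero : ∀ (xs : List A) → ∑ xs (λ _ → 0ℤ) ≡ 0ℤ
∑-zero []       = refl
∑-zero (x ∷ xs) = trans (ℤₚ.+-identityˡ _) (∑-zero xs)

∑-+ : ∀ (xs : List A) (f g : A → ℤ) → ∑ xs (λ x → f x + g x) ≡ ∑ xs f + ∑ xs g
∑-+ []       f g = refl
∑-+ (x ∷ xs) f g = trans (cong (λ t → f x + g x + t) (∑-+ xs f g)) (lemma (f x) (g x) (∑ xs f) (∑ xs g))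
  where
  lemma : ∀ a b c d → (a + b) + (c + d) ≡ (a + c) + (b + d)
  lemma = solve-∀

∑-*ˡ : ∀ (xs : List A) c (f : A → ℤ) → ∑ xs (λ x → c * f x) ≡ c * ∑ xs f
∑-*ˡ []       c f = sym (ℤₚ.*-zeroʳ c)
∑-*ˡ (x ∷ xs) c f = trans (cong (λ t → c * f x + t) (∑-*ˡ xs c f)) (sym (ℤₚ.*-distribˡ-+ c (f x) (∑ xs f)))

∑-when : ∀ b (xs : List A) (f : A → ℤ) → ∑ xs (λ x → when b (f x)) ≡ when b (∑ xs f)
∑-when true  xs f = refl
∑-when false xs f = ∑-zero xs

∑-comm : ∀ (xs : List A) (ys : List B) (f : A → B → ℤ) →
         ∑ xs (λ x → ∑ ys (f x)) ≡ ∑ ys (λ y → ∑ xs (λ x → f x y))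
∑-comm []       ys f = sym (∑-zero ys)
∑-comm (x ∷ xs) ys f = trans (cong (λ t → ∑ ys (f x) + t) (∑-comm xs ys f))
                             (sym (∑-+ ys (f x) (λ y → ∑ xs (λ x → f x y))))

∑-++ : ∀ (xs ys : List A) (f : A → ℤ) → ∑ (xs ++ ys) f ≡ ∑ xs f + ∑ ys f
∑-++ []       ys f = sym (ℤₚ.+-identityˡ (∑ ys f))
∑-++ (x ∷ xs) ys f = trans (cong (λ t → f x + t) (∑-++ xs ys f)) (sym (ℤₚ.+-assoc (f x) (∑ xs f) (∑ ys f)))

∑-map : ∀ (g : A → B) xs (f : B → ℤ) → ∑ (map g xs) f ≡ ∑ xs (f ∘ g)
∑-map g []       f = refl
∑-map g (x ∷ xs) f = cong (λ t → f (g x) + t) (∑-map g xs f)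

∑-filter : ∀ {P : A → Set} (P? : ∀ x → Dec (P x)) xs (f : A → ℤ) →
           ∑ (filter P? xs) f ≡ ∑ xs (λ x → when (does (P? x)) (f x))
∑-filter P? []       f = refl
∑-filter P? (x ∷ xs) f with does (P? x)
... | true  = cong (λ t → f x + t) (∑-filter P? xs f)
... | false = trans (∑-filter P? xs f) (sym (ℤₚ.+-identityˡ _))

∑-allSubsets : ∀ (f : Subset (suc n) → ℤ) →
               ∑ (allSubsets (suc n)) f ≡ ∑ (allSubsets n) (f ∘ (outside ∷_)) + ∑ (allSubsets n) (f ∘ (inside ∷_))
∑-allSubsets {n} f = trans (∑-++ (map (outside ∷_) (allSubsets n)) (map (inside ∷_) (allSubsets n)) f)
  (cong₂ _+_ (∑-map (outside ∷_) (allSubsets n) f) (∑-map (inside ∷_) (allSubsets n) f))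

-- h-vectors as sums over faces

-- This is `w` cut off at `m`. It expresses an h-vector as a sum over faces before any bound on
-- their sizes is known, as is the case for the subdivision.
truncate : ℕ → (ℕ → ℤ) → ℕ → ℤ
truncate m w n = sum {m} λ i → when (does (n ℕₚ.≟ toℕ i)) (w (toℕ i))

truncate-< : ∀ {m n} (w : ℕ → ℤ) → n ℕ.< m → truncate m w n ≡ w n
truncate-< {suc m} {zero}  w _         =
  trans (cong (λ t → w 0 + t) (sum-zero {m} _ λ _ → refl)) (ℤₚ.+-identityʳ (w 0))
truncate-< {suc m} {suc n} w (s≤s n<m) =
  trans (ℤₚ.+-identityˡ _) (truncate-< (w ∘ suc) n<m)

count-sum : ∀ m (size : A → ℕ) (w : ℕ → ℤ) xs →
            sum {m} (λ i → + length (filter (λ x → size x ℕₚ.≟ toℕ i) xs) * w (toℕ i)) ≡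
            ∑ xs (truncate m w ∘ size)
count-sum m size w []       = sum-zero {m} _ λ _ → refl
count-sum {A} m size w (x ∷ xs) = begin
  sum {m} (λ i → count (x ∷ xs) i * w (toℕ i))                 ≡⟨ sum-cong-≗ {m} cons ⟩
  sum {m} (λ i → hit i + count xs i * w (toℕ i))               ≡⟨ ∑-distrib-+ {m} hit (λ i → count xs i * w (toℕ i)) ⟩
  sum {m} hit + sum {m} (λ i → count xs i * w (toℕ i))         ≡⟨ cong (λ t → sum {m} hit + t) (count-sum m size w xs) ⟩
  ∑ (x ∷ xs) (truncate m w ∘ size)                             ∎
  where
  open ≡-Reasoning
  count : List A → Fin m → ℤ
  count ys i = + length (filter (λ y → size y ℕₚ.≟ toℕ i) ys)
  hit : Fin m → ℤ
  hit i = when (does (size x ℕₚ.≟ toℕ i)) (w (toℕ i))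
  lemma : ∀ k x → (1ℤ + k) * x ≡ x + k * x
  lemma = solve-∀
  cons : ∀ i → count (x ∷ xs) i * w (toℕ i) ≡ hit i + count xs i * w (toℕ i)
  cons i with does (size x ℕₚ.≟ toℕ i)
  ... | true  = lemma (count xs i) (w (toℕ i))
  ... | false = sym (ℤₚ.+-identityˡ _)

hWeight : ℕ → ℕ → ℕ → ℤ
hWeight d k i = (x^ i · ([1-x]^ (d ∸ i))) k

hVector-∑ : ∀ d (Δ : SimplicialComplex n) i →
            hVector d Δ i ≡ ∑ (faces Δ) (truncate (suc d) (hWeight d (toℕ i)) ∘ ∣_∣)
hVector-∑ d Δ i = count-sum (suc d) ∣_∣ (hWeight d (toℕ i)) (faces Δ)

-- Chains as cliques of the comparability relation

module _ (cmp : A → A → Bool) where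

  -- The predicate `q` accumulates the conditions imposed by the elements already chosen.
  clique : (L : List A) → (A → Bool) → Subset (length L) → Bool
  clique []      q []            = true
  clique (a ∷ L) q (outside ∷ S) = clique L q S
  clique (a ∷ L) q (inside ∷ S)  = q a ∧ clique L (λ b → q b ∧ cmp a b) S

  cliqueSum : List A → (A → Bool) → (ℕ → ℤ) → ℤ
  cliqueSum []      q G = G 0
  cliqueSum (a ∷ L) q G = cliqueSum L q G + when (q a) (cliqueSum L (λ b → q b ∧ cmp a b) (G ∘ suc))

  ∑-clique : ∀ L q G → ∑ (allSubsets (length L)) (λ S → when (clique L q S) (G ∣ S ∣)) ≡ cliqueSum L q G
  ∑-clique []      q G = ℤₚ.+-identityʳ (G 0)
  ∑-clique (a ∷ L) q G = trans (∑-allSubsets (λ S → when (clique (a ∷ L) q S) (G ∣ S ∣)))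
    (cong₂ _+_ (∑-clique L q G) (chosen (q a)))
    where
    chosen : ∀ b → ∑ (allSubsets (length L)) (λ S → when (b ∧ clique L (λ c → q c ∧ cmp a c) S) (G (suc ∣ S ∣))) ≡
                   when b (cliqueSum L (λ c → q c ∧ cmp a c) (G ∘ suc))
    chosen true  = ∑-clique L (λ c → q c ∧ cmp a c) (G ∘ suc)
    chosen false = ∑-zero (allSubsets (length L))

  cliqueSum-cong : ∀ L {q q′} G → (∀ {b} → b ∈ₗ L → q b ≡ q′ b) → cliqueSum L q G ≡ cliqueSum L q′ G
  cliqueSum-cong []      G q≗q′ = refl
  cliqueSum-cong (a ∷ L) G q≗q′ = cong₂ _+_ (cliqueSum-cong L G (q≗q′ ∘ there))
    (cong₂ when (q≗q′ (here refl)) (cliqueSum-cong L (G ∘ suc) λ b∈L → cong (_∧ cmp a _) (q≗q′ (there b∈L))))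

  cliqueSum-cong-weight : ∀ L q {G G′} → G ≗ G′ → cliqueSum L q G ≡ cliqueSum L q G′
  cliqueSum-cong-weight []      q G≗G′ = G≗G′ 0
  cliqueSum-cong-weight (a ∷ L) q G≗G′ =
    cong₂ _+_ (cliqueSum-cong-weight L q G≗G′) (cong (when (q a)) (cliqueSum-cong-weight L _ (G≗G′ ∘ suc)))

  cliqueSum-zero : ∀ L q → cliqueSum L q (λ _ → 0ℤ) ≡ 0ℤ
  cliqueSum-zero []      q = refl
  cliqueSum-zero (a ∷ L) q =
    cong₂ _+_ (cliqueSum-zero L q) (trans (cong (when (q a)) (cliqueSum-zero L _)) (when-0 (q a)))

  cliqueSum-+ : ∀ L q G G′ → cliqueSum L q (λ i → G i + G′ i) ≡ cliqueSum L q G + cliqueSum L q G′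
  cliqueSum-+ []      q G G′ = refl
  cliqueSum-+ (a ∷ L) q G G′ = begin
    cliqueSum L q (λ i → G i + G′ i) + when (q a) (cliqueSum L q⁺ (λ i → G (suc i) + G′ (suc i)))
      ≡⟨ cong₂ (λ x y → x + when (q a) y) (cliqueSum-+ L q G G′) (cliqueSum-+ L q⁺ (G ∘ suc) (G′ ∘ suc)) ⟩
    (w + w′) + when (q a) (v + v′)
      ≡⟨ cong (λ t → (w + w′) + t) (when-+ (q a) v v′) ⟩
    (w + w′) + (when (q a) v + when (q a) v′)
      ≡⟨ lemma w w′ (when (q a) v) (when (q a) v′) ⟩
    (w + when (q a) v) + (w′ + when (q a) v′) ∎
    where
    open ≡-Reasoning
    q⁺ : A → Bool
    q⁺ b = q b ∧ cmp a b
    w = cliqueSum L q G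
    w′ = cliqueSum L q G′
    v = cliqueSum L q⁺ (G ∘ suc)
    v′ = cliqueSum L q⁺ (G′ ∘ suc)
    lemma : ∀ a b c d → (a + b) + (c + d) ≡ (a + c) + (b + d)
    lemma = solve-∀

  -- `cliqueSum` is linear in its weight, so differences in a parameter can be taken outside.
  cliqueSum-∇^ : ∀ m L q (g : ℕ → Polynomial) k →
                 cliqueSum L q (λ i → ∇^ m (g i) k) ≡ ∇^ m (λ r → cliqueSum L q (λ i → g i r)) k
  cliqueSum-∇^ m []      q g k = refl
  cliqueSum-∇^ m (a ∷ L) q g k with q a
  ... | true  = trans (cong₂ _+_ (cliqueSum-∇^ m L q g k) (cliqueSum-∇^ m L _ (g ∘ suc) k))
                  (sym (∇^-+ m (λ r → cliqueSum L q (λ i → g i r)) (λ r → cliqueSum L _ (λ i → g (suc i) r)) k))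
  ... | false = trans (ℤₚ.+-identityʳ _) (trans (cliqueSum-∇^ m L q g k)
                  (∇^-cong m (λ r → sym (ℤₚ.+-identityʳ _)) k))

  module _ (_<ᵇ_ : A → A → Bool) where

    -- States that the list order extends `<ᵇ`: an element comparable to an earlier one lies above
    -- it.
    record Before (a b : A) : Set where
      field
        cmp≡< : cmp a b ≡ (a <ᵇ b)
        b≮a   : (b <ᵇ a) ≡ false

    -- Classifies a clique by its first element a; the rest lies above a.
    cliqueSum-expand : (∀ a → (a <ᵇ a) ≡ false) → ∀ {L} → AllPairs Before L → ∀ q G →
      cliqueSum L q G ≡ G 0 + ∑ L (λ a → when (q a) (cliqueSum L (λ b → q b ∧ (a <ᵇ b)) (G ∘ suc)))
    cliqueSum-expand irrefl {[]}    _              q G = sym (ℤₚ.+-identityʳ (G 0))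
    cliqueSum-expand irrefl {x ∷ L} (x<L ∷ sorted) q G = begin
      cliqueSum L q G + when (q x) (cliqueSum L (λ b → q b ∧ cmp x b) (G ∘ suc))
        ≡⟨ cong₂ (λ s t → s + when (q x) t) (cliqueSum-expand irrefl sorted q G)
             (cliqueSum-cong L (G ∘ suc) λ {b} b∈L → cong (q b ∧_) (Before.cmp≡< (All.lookup x<L b∈L))) ⟩
      G 0 + rest + when (q x) (cliqueSum L (above x) (G ∘ suc))
        ≡⟨ cong (λ t → G 0 + rest + when (q x) t) (sym (skip x (irrefl x))) ⟩
      G 0 + rest + when (q x) (cliqueSum (x ∷ L) (above x) (G ∘ suc))
        ≡⟨ lemma (G 0) rest (when (q x) (cliqueSum (x ∷ L) (above x) (G ∘ suc))) ⟩
      G 0 + (when (q x) (cliqueSum (x ∷ L) (above x) (G ∘ suc)) + rest)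
        ≡⟨ cong (λ t → G 0 + (when (q x) (cliqueSum (x ∷ L) (above x) (G ∘ suc)) + t))
             (∑-cong-∈ L λ {a} a∈L → cong (when (q a)) (sym (skip a (Before.b≮a (All.lookup x<L a∈L))))) ⟩
      G 0 + ∑ (x ∷ L) (λ a → when (q a) (cliqueSum (x ∷ L) (above a) (G ∘ suc))) ∎
      where
      open ≡-Reasoning
      above : A → A → Bool
      above a b = q b ∧ (a <ᵇ b)
      rest = ∑ L (λ a → when (q a) (cliqueSum L (above a) (G ∘ suc)))
      lemma : ∀ a b c → a + b + c ≡ a + (c + b)
      lemma = solve-∀
      -- The head x is above neither itself nor any later a, so the inner sums may run over the
      -- whole list.
      skip : ∀ a → (a <ᵇ x) ≡ false → cliqueSum (x ∷ L) (above a) (G ∘ suc) ≡ cliqueSum L (above a) (G ∘ suc)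
      skip a a≮x rewrite a≮x | ∧-zeroʳ (q x) = ℤₚ.+-identityʳ _

T-∧⁺ : ∀ {a b} → T a → T b → T (a ∧ b)
T-∧⁺ {a} ta tb = Equivalence.from (T-∧ {a}) (ta , tb)

T-∧⁻ : ∀ {a b} → T (a ∧ b) → T a × T b
T-∧⁻ {a} = Equivalence.to (T-∧ {a})

module _ {R : A → A → Set} (R? : ∀ a b → Dec (R a b)) (R-refl : ∀ a → R a a) (R-sym : ∀ {a b} → R a b → R b a) where

  private
    cmp : A → A → Bool
    cmp a b = does (R? a b)

    cmp⁺ : ∀ {a b} → R a b → T (cmp a b)
    cmp⁺ {a} {b} r = subst T (sym (dec-true (R? a b) r)) tt

    cmp⁻ : ∀ {a b} → T (cmp a b) → R a b
    cmp⁻ {a} {b} t with R? a b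
    ... | yes r = r

  PairwiseRelated : (L : List A) → Subset (length L) → Set
  PairwiseRelated L S = ∀ i → i ∈ S → ∀ j → j ∈ S → R (lookup L i) (lookup L j)

  -- The Boolean test compares each chosen element only with earlier ones; `R-refl` and `R-sym`
  -- supply the other pairs.
  clique-sound : ∀ L q S → T (clique cmp L q S) → (∀ i → i ∈ S → T (q (lookup L i))) × PairwiseRelated L S
  clique-sound []      q []            t = (λ ()) , λ ()
  clique-sound (a ∷ L) q (outside ∷ S) t with clique-sound L q S t
  ... | qS , rS = (λ { (suc i) (there i∈S) → qS i i∈S })
                , λ { (suc i) (there i∈S) (suc j) (there j∈S) → rS i i∈S j j∈S }
  clique-sound (a ∷ L) q (inside ∷ S) t with T-∧⁻ {q a} t
  ... | qa , t′ with clique-sound L _ S t′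
  ... | qS , rS = (λ { zero here → qa ; (suc i) (there i∈S) → proj₁ (T-∧⁻ {q (lookup L i)} (qS i i∈S)) })
                , λ { zero    here        zero    here        → R-refl a
                    ; zero    here        (suc j) (there j∈S) → related j j∈S
                    ; (suc i) (there i∈S) zero    here        → R-sym (related i i∈S)
                    ; (suc i) (there i∈S) (suc j) (there j∈S) → rS i i∈S j j∈S }
    where
    related : ∀ i → i ∈ S → R a (lookup L i)
    related i i∈S = cmp⁻ (proj₂ (T-∧⁻ {q (lookup L i)} (qS i i∈S)))

  clique-complete : ∀ L q S → (∀ i → i ∈ S → T (q (lookup L i))) → PairwiseRelated L S → T (clique cmp L q S)
  clique-complete []      q []            qS rS = tt
  clique-complete (a ∷ L) q (outside ∷ S) qS rS =
    clique-complete L q S (λ i i∈S → qS (suc i) (there i∈S)) (λ i i∈S j j∈S → rS (suc i) (there i∈S) (suc j) (there j∈S))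
  clique-complete (a ∷ L) q (inside ∷ S)  qS rS = T-∧⁺ {q a} (qS zero here)
    (clique-complete L _ S
      (λ i i∈S → T-∧⁺ {q (lookup L i)} (qS (suc i) (there i∈S)) (cmp⁺ (rS zero here (suc i) (there i∈S))))
      (λ i i∈S j j∈S → rS (suc i) (there i∈S) (suc j) (there j∈S)))

  clique-does : ∀ L S (D? : Dec (PairwiseRelated L S)) → does D? ≡ clique cmp L (const true) S
  clique-does L S D? = does-⇔ (mk⇔ (clique-complete L (const true) S (λ _ _ → tt))
                                    (proj₂ ∘ clique-sound L (const true) S)) D? (T? _)

-- Multichains of faces

infix 4 _⊆ᵇ_ _⊊ᵇ_
_⊆ᵇ_ _⊊ᵇ_ : Subset n → Subset n → Bool
p ⊆ᵇ q = does (p ⊆? q)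
p ⊊ᵇ q = (p ⊆ᵇ q) ∧ not (q ⊆ᵇ p)

⊊ᵇ-irrefl : ∀ (p : Subset n) → (p ⊊ᵇ p) ≡ false
⊊ᵇ-irrefl p rewrite dec-true (p ⊆? p) ⊆-refl = refl

⊊ᵇ-sound : ∀ (p q : Subset n) → (p ⊊ᵇ q) ≡ true → p ⊆ q × (q ⊆ᵇ p) ≡ false
⊊ᵇ-sound p q p⊊q with p ⊆? q | q ⊆? p | p⊊q
... | yes p⊆q | no _ | _ = p⊆q , refl

⊊ᵇ-complete : ∀ (p q : Subset n) → p ⊆ q → (q ⊆ᵇ p) ≡ false → (p ⊊ᵇ q) ≡ true
⊊ᵇ-complete p q p⊆q q⊈p rewrite dec-true (p ⊆? q) p⊆q | q⊈p = refl

⊆ᵇ-false : ∀ {p q : Subset n} → (p ⊆ᵇ q) ≡ false → p ⊆ q → Empty.⊥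
⊆ᵇ-false {p = p} {q} p⊈q p⊆q = case trans (sym p⊈q) (dec-true (p ⊆? q) p⊆q) of λ ()

⊊ᵇ-trans : ∀ (p a b : Subset n) → (p ⊊ᵇ a) ≡ true → (a ⊊ᵇ b) ≡ true → (p ⊊ᵇ b) ≡ true
⊊ᵇ-trans p a b p⊊a a⊊b with ⊊ᵇ-sound p a p⊊a | ⊊ᵇ-sound a b a⊊b
... | p⊆a , a⊈p | a⊆b , _ = ⊊ᵇ-complete p b (⊆-trans p⊆a a⊆b)
  (dec-false (b ⊆? p) λ b⊆p → ⊆ᵇ-false a⊈p (⊆-trans a⊆b b⊆p))

⊊ᵇ-size : ∀ (p q : Subset n) → (p ⊊ᵇ q) ≡ true → ∣ p ∣ ℕ.< ∣ q ∣
⊊ᵇ-size p q p⊊q with p ⊂? q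
... | yes p⊂q = p⊂q⇒∣p∣<∣q∣ p⊂q
... | no  p⊄q = contradiction (λ {x} x∈q → decidable-stable (x ∈? p) λ x∉p → p⊄q (p⊆q , x , x∈q , x∉p)) (⊆ᵇ-false q⊈p)
  where
  p⊆q = proj₁ (⊊ᵇ-sound p q p⊊q)
  q⊈p = proj₂ (⊊ᵇ-sound p q p⊊q)

-- power r p q is r ^ ∣ q ─ p ∣ if p ⊆ q and 0 otherwise: the number of
-- multichains p ⊆ p₁ ⊆ … ⊆ p_r = q, as each element of q ─ p may join at any
-- of the r steps.
power : ℤ → Subset n → Subset n → ℤ
power r []            []            = 1ℤ
power r (outside ∷ p) (outside ∷ q) = power r p q
power r (outside ∷ p) (inside ∷ q)  = r * power r p q
power r (inside ∷ p)  (outside ∷ q) = 0ℤ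
power r (inside ∷ p)  (inside ∷ q)  = power r p q

power-⊥ : ∀ r (q : Subset n) → power r ⊥ q ≡ r ℤ.^ ∣ q ∣
power-⊥ r []            = refl
power-⊥ r (outside ∷ q) = power-⊥ r q
power-⊥ r (inside ∷ q)  = cong (r *_) (power-⊥ r q)

power-⊈ : ∀ r (p q : Subset n) → (p ⊆ᵇ q) ≡ false → power r p q ≡ 0ℤ
power-⊈ r []            []            ()
power-⊈ r (outside ∷ p) (outside ∷ q) p⊈q = power-⊈ r p q p⊈q
power-⊈ r (outside ∷ p) (inside ∷ q)  p⊈q = trans (cong (r *_) (power-⊈ r p q p⊈q)) (ℤₚ.*-zeroʳ r)
power-⊈ r (inside ∷ p)  (outside ∷ q) p⊈q = refl
power-⊈ r (inside ∷ p)  (inside ∷ q)  p⊈q = power-⊈ r p q p⊈q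

power-1 : ∀ (p q : Subset n) → power 1ℤ p q ≡ when (p ⊆ᵇ q) 1ℤ
power-1 []            []            = refl
power-1 (outside ∷ p) (outside ∷ q) = power-1 p q
power-1 (outside ∷ p) (inside ∷ q)  = trans (ℤₚ.*-identityˡ _) (power-1 p q)
power-1 (inside ∷ p)  (outside ∷ q) = refl
power-1 (inside ∷ p)  (inside ∷ q)  = power-1 p q

power-0 : ∀ (p q : Subset n) → power 0ℤ p q ≡ when ((p ⊆ᵇ q) ∧ (q ⊆ᵇ p)) 1ℤ
power-0 []            []            = refl
power-0 (outside ∷ p) (outside ∷ q) = power-0 p q
power-0 (outside ∷ p) (inside ∷ q)  rewrite ∧-zeroʳ (p ⊆ᵇ q) = refl
power-0 (inside ∷ p)  (outside ∷ q) = refl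
power-0 (inside ∷ p)  (inside ∷ q)  = power-0 p q

-- A single step of a multichain either stays in place or climbs strictly.
power-1-split : ∀ (p q : Subset n) → power 1ℤ p q ≡ power 0ℤ p q + when (p ⊊ᵇ q) 1ℤ
power-1-split p q rewrite power-1 p q | power-0 p q with p ⊆ᵇ q | q ⊆ᵇ p
... | true  | true  = refl
... | true  | false = refl
... | false | _     = refl

-- `power 0ℤ` is the identity of the incidence algebra of the Boolean lattice.
∑-power-0 : ∀ (p : Subset n) (g : Subset n → ℤ) → ∑ (allSubsets n) (λ q → power 0ℤ p q * g q) ≡ g p
∑-power-0 {zero}  []            g = lemma (g [])
  where
  lemma : ∀ x → 1ℤ * x + 0ℤ ≡ x
  lemma = solve-∀
∑-power-0 {suc n} (outside ∷ p) g = begin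
  ∑ (allSubsets (suc n)) (λ q → power 0ℤ (outside ∷ p) q * g q)
    ≡⟨ ∑-allSubsets (λ q → power 0ℤ (outside ∷ p) q * g q) ⟩
  ∑ (allSubsets n) (λ q → power 0ℤ p q * g (outside ∷ q)) + ∑ (allSubsets n) (λ _ → 0ℤ)
    ≡⟨ cong₂ _+_ (∑-power-0 p (g ∘ (outside ∷_))) (∑-zero (allSubsets n)) ⟩
  g (outside ∷ p) + 0ℤ
    ≡⟨ ℤₚ.+-identityʳ (g (outside ∷ p)) ⟩
  g (outside ∷ p) ∎
  where open ≡-Reasoning
∑-power-0 {suc n} (inside ∷ p)  g = begin
  ∑ (allSubsets (suc n)) (λ q → power 0ℤ (inside ∷ p) q * g q)
    ≡⟨ ∑-allSubsets (λ q → power 0ℤ (inside ∷ p) q * g q) ⟩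
  ∑ (allSubsets n) (λ _ → 0ℤ) + ∑ (allSubsets n) (λ q → power 0ℤ p q * g (inside ∷ q))
    ≡⟨ cong₂ _+_ (∑-zero (allSubsets n)) (∑-power-0 p (g ∘ (inside ∷_))) ⟩
  0ℤ + g (inside ∷ p)
    ≡⟨ ℤₚ.+-identityˡ (g (inside ∷ p)) ⟩
  g (inside ∷ p) ∎
  where open ≡-Reasoning

-- Concatenation of multichains: each element of q outside p joins in the first leg or in the
-- second, which gives the factor s + r.
∑-power-* : ∀ s r (p q : Subset n) → ∑ (allSubsets n) (λ a → power s p a * power r a q) ≡ power (s + r) p q
∑-power-* {zero}  s r []      []      = refl
∑-power-* {suc n} s r (x ∷ p) (y ∷ q) = trans (∑-allSubsets (λ a → power s (x ∷ p) a * power r a (y ∷ q))) (heads x y)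
  where
  open ≡-Reasoning
  AllS = allSubsets n
  heads : ∀ x y →
    ∑ AllS (λ a → power s (x ∷ p) (outside ∷ a) * power r (outside ∷ a) (y ∷ q)) +
    ∑ AllS (λ a → power s (x ∷ p) (inside ∷ a) * power r (inside ∷ a) (y ∷ q)) ≡ power (s + r) (x ∷ p) (y ∷ q)
  heads outside outside = trans
    (cong₂ _+_ (∑-power-* s r p q)
       (trans (∑-cong AllS λ a → ℤₚ.*-zeroʳ (s * power s p a)) (∑-zero AllS)))
    (ℤₚ.+-identityʳ _)
  heads outside inside = begin
    ∑ AllS (λ a → power s p a * (r * power r a q)) + ∑ AllS (λ a → s * power s p a * power r a q)
      ≡⟨ cong₂ _+_ (∑-cong AllS λ a → lemma (power s p a) r (power r a q))
                   (∑-cong AllS λ a → ℤₚ.*-assoc s (power s p a) (power r a q)) ⟩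
    ∑ AllS (λ a → r * (power s p a * power r a q)) + ∑ AllS (λ a → s * (power s p a * power r a q))
      ≡⟨ cong₂ _+_ (∑-*ˡ AllS r _) (∑-*ˡ AllS s _) ⟩
    r * ∑ AllS (λ a → power s p a * power r a q) + s * ∑ AllS (λ a → power s p a * power r a q)
      ≡⟨ cong (λ t → r * t + s * t) (∑-power-* s r p q) ⟩
    r * power (s + r) p q + s * power (s + r) p q
      ≡⟨ lemma′ r s (power (s + r) p q) ⟩
    (s + r) * power (s + r) p q ∎
    where
    lemma : ∀ a b c → a * (b * c) ≡ b * (a * c)
    lemma = solve-∀
    lemma′ : ∀ a b c → a * c + b * c ≡ (b + a) * c
    lemma′ = solve-∀
  heads inside outside =
    cong₂ _+_ (∑-zero AllS) (trans (∑-cong AllS λ a → ℤₚ.*-zeroʳ (power s p a)) (∑-zero AllS))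
  heads inside inside = trans (cong₂ _+_ (∑-zero AllS) (∑-power-* s r p q)) (ℤₚ.+-identityˡ _)

-- Sets without the first point are listed first, and no set containing that point lies inside one
-- of them.
allSubsets-sorted : ∀ n → AllPairs (λ p q → (q ⊆ᵇ p) ≡ false) (allSubsets n)
allSubsets-sorted zero    = [] ∷ []
allSubsets-sorted (suc n) = AllPairsₚ.++⁺
  (AllPairsₚ.map⁺ (allSubsets-sorted n)) (AllPairsₚ.map⁺ (allSubsets-sorted n))
  (Allₚ.map⁺ (All.universal (λ p → Allₚ.map⁺ (All.universal (λ q → refl) (allSubsets n))) (allSubsets n)))

Comparable? : ∀ (p q : Subset n) → Dec (p ⊆ q ⊎ q ⊆ p)
Comparable? p q = (p ⊆? q) ⊎-dec (q ⊆? p)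

comparable : Subset n → Subset n → Bool
comparable p q = does (Comparable? p q)

binomial : ℕ → ℕ → ℤ
binomial r i = + (r C i)

binomial-suc : ∀ r i → binomial (suc r) (suc i) ≡ binomial r i + binomial r (suc i)
binomial-suc r i = cong +_ (sym (nCk+nC[k+1]≡[n+1]C[k+1] r i))

module Chains (Δ : SimplicialComplex n) where

  L : List (Subset n)
  L = nonemptyFaces Δ

  isFace : Subset n → Bool
  isFace p = does (Face? Δ p)

  L-sorted : AllPairs (Before comparable _⊊ᵇ_) L
  L-sorted = AllPairs.map before
    (AllPairsₚ.filter⁺ nonempty? (AllPairsₚ.filter⁺ (Face? Δ) (allSubsets-sorted n)))
    where
    before : ∀ {p q} → (q ⊆ᵇ p) ≡ false → Before comparable _⊊ᵇ_ p q
    before {p} {q} q⊈p = record { cmp≡< = cmp≡< ; b≮a = b≮a }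
      where
      cmp≡< : comparable p q ≡ (p ⊊ᵇ q)
      cmp≡< rewrite q⊈p with p ⊆ᵇ q
      ... | true  = refl
      ... | false = refl
      b≮a : (q ⊊ᵇ p) ≡ false
      b≮a rewrite q⊈p = refl

  -- Sums over the chains of faces strictly above `p`, with `p` itself not counted in the length.
  chainSum : Subset n → (ℕ → ℤ) → ℤ
  chainSum p G = cliqueSum comparable L (p ⊊ᵇ_) G

  ⊊ᵇ-nonempty : ∀ (p a : Subset n) → (p ⊊ᵇ a) ≡ true → does (nonempty? a) ≡ true
  ⊊ᵇ-nonempty p a p⊊a with p ⊂? a
  ... | yes (_ , x , x∈a , _) = dec-true (nonempty? a) (x , x∈a)
  ... | no p⊄a = dec-true (nonempty? a) (decidable-stable (nonempty? a) λ a-empty →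
        ⊆ᵇ-false (proj₂ (⊊ᵇ-sound p a p⊊a)) λ {x} x∈a → contradiction (x , x∈a) a-empty)

  -- Here a is the smallest element of the chain. By transitivity the rest need only lie above a,
  -- and a set strictly above `p` is nonempty.
  chainSum-expand : ∀ p G → chainSum p G ≡
    G 0 + ∑ (allSubsets n) (λ a → when (isFace a) (when (p ⊊ᵇ a) (chainSum a (G ∘ suc))))
  chainSum-expand p G = begin
    chainSum p G
      ≡⟨ cliqueSum-expand comparable _⊊ᵇ_ ⊊ᵇ-irrefl L-sorted (p ⊊ᵇ_) G ⟩
    G 0 + ∑ L (λ a → when (p ⊊ᵇ a) (cliqueSum comparable L (λ b → (p ⊊ᵇ b) ∧ (a ⊊ᵇ b)) (G ∘ suc)))
      ≡⟨ cong (λ t → G 0 + t) (∑-cong L restart) ⟩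
    G 0 + ∑ L (λ a → when (p ⊊ᵇ a) (chainSum a (G ∘ suc)))
      ≡⟨ cong (λ t → G 0 + t) (trans (∑-filter nonempty? (faces Δ) _) (∑-filter (Face? Δ) (allSubsets n) _)) ⟩
    G 0 + ∑ (allSubsets n) (λ a → when (isFace a) (when (does (nonempty? a)) (when (p ⊊ᵇ a) (chainSum a (G ∘ suc)))))
      ≡⟨ cong (λ t → G 0 + t) (∑-cong (allSubsets n) λ a → cong (when (isFace a)) (drop a)) ⟩
    G 0 + ∑ (allSubsets n) (λ a → when (isFace a) (when (p ⊊ᵇ a) (chainSum a (G ∘ suc)))) ∎
    where
    open ≡-Reasoning
    restart : ∀ a → when (p ⊊ᵇ a) (cliqueSum comparable L (λ b → (p ⊊ᵇ b) ∧ (a ⊊ᵇ b)) (G ∘ suc)) ≡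
                    when (p ⊊ᵇ a) (chainSum a (G ∘ suc))
    restart a with p ⊊ᵇ a in p⊊a
    ... | false = refl
    ... | true  = cliqueSum-cong comparable L (G ∘ suc) λ {b} _ → absorb b
      where
      absorb : ∀ b → (p ⊊ᵇ b) ∧ (a ⊊ᵇ b) ≡ (a ⊊ᵇ b)
      absorb b with a ⊊ᵇ b in a⊊b
      ... | false = ∧-zeroʳ (p ⊊ᵇ b)
      ... | true  = cong (_∧ true) (⊊ᵇ-trans p a b p⊊a a⊊b)
    drop : ∀ a → when (does (nonempty? a)) (when (p ⊊ᵇ a) (chainSum a (G ∘ suc))) ≡ when (p ⊊ᵇ a) (chainSum a (G ∘ suc))
    drop a with p ⊊ᵇ a in p⊊a
    ... | false = when-0 (does (nonempty? a))
    ... | true  = cong (λ b → when b (chainSum a (G ∘ suc))) (⊊ᵇ-nonempty p a p⊊a)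

  -- Counts the r-step multichains of faces starting at `p`; the intermediate sets are faces as soon
  -- as the last one is.
  zeta : ℕ → Subset n → ℤ
  zeta r p = ∑ (allSubsets n) (λ q → when (isFace q) (power (+ r) p q))

  zeta-nonface : ∀ r a → when (isFace a) (zeta r a) ≡ zeta r a
  zeta-nonface r a with Face? Δ a
  ... | yes _  = refl
  ... | no ¬Fa = sym (trans (∑-cong (allSubsets n) vanish) (∑-zero (allSubsets n)))
    where
    vanish : ∀ q → when (isFace q) (power (+ r) a q) ≡ 0ℤ
    vanish q with Face? Δ q
    ... | no _   = refl
    ... | yes Fq = power-⊈ (+ r) a q (dec-false (a ⊆? q) λ a⊆q → ¬Fa (⊆-face Δ a⊆q Fq))

  -- A multichain of r steps amounts to the chain of i distinct faces it visits above `p` and the i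
  -- steps at which it climbs, hence the weight C(r, i). The induction splits off the first step by
  -- Pascal's rule.
  chainSum-binomial : ∀ r p → Face Δ p → chainSum p (binomial r) ≡ zeta r p
  chainSum-binomial zero p Fp = begin
    chainSum p (binomial 0)
      ≡⟨ chainSum-expand p (binomial 0) ⟩
    1ℤ + ∑ (allSubsets n) (λ a → when (isFace a) (when (p ⊊ᵇ a) (chainSum a (λ _ → 0ℤ))))
      ≡⟨ cong (λ t → 1ℤ + t) (trans (∑-cong (allSubsets n) vanish) (∑-zero (allSubsets n))) ⟩
    1ℤ
      ≡⟨ cong (λ b → when b 1ℤ) (dec-true (Face? Δ p) Fp) ⟨
    when (isFace p) 1ℤ
      ≡⟨ ∑-power-0 p (λ q → when (isFace q) 1ℤ) ⟨
    ∑ (allSubsets n) (λ q → power 0ℤ p q * when (isFace q) 1ℤ)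
      ≡⟨ ∑-cong (allSubsets n) (λ q → sym (when-* (isFace q) (power 0ℤ p q) 1ℤ)) ⟩
    ∑ (allSubsets n) (λ q → when (isFace q) (power 0ℤ p q * 1ℤ))
      ≡⟨ ∑-cong (allSubsets n) (λ q → cong (when (isFace q)) (ℤₚ.*-identityʳ (power 0ℤ p q))) ⟩
    zeta 0 p ∎
    where
    open ≡-Reasoning
    vanish : ∀ a → when (isFace a) (when (p ⊊ᵇ a) (chainSum a (λ _ → 0ℤ))) ≡ 0ℤ
    vanish a rewrite cliqueSum-zero comparable L (a ⊊ᵇ_) | when-0 (p ⊊ᵇ a) = when-0 (isFace a)
  chainSum-binomial (suc r) p Fp = begin
    chainSum p (binomial (suc r))
      ≡⟨ chainSum-expand p (binomial (suc r)) ⟩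
    1ℤ + ∑ (allSubsets n) (λ a → when (isFace a) (when (p ⊊ᵇ a) (chainSum a (binomial (suc r) ∘ suc))))
      ≡⟨ cong (λ t → 1ℤ + t) (trans (∑-cong (allSubsets n) pascal) (∑-+ (allSubsets n) (above (binomial r)) (above (binomial r ∘ suc)))) ⟩
    1ℤ + (∑ (allSubsets n) (above (binomial r)) + ∑ (allSubsets n) (above (binomial r ∘ suc)))
      ≡⟨ swap-+ 1ℤ (∑ (allSubsets n) (above (binomial r))) (∑ (allSubsets n) (above (binomial r ∘ suc))) ⟩
    1ℤ + ∑ (allSubsets n) (above (binomial r ∘ suc)) + ∑ (allSubsets n) (above (binomial r))
      -- The first part collects the multichains whose first step stays at `p`, the second those
      -- that climb to a.
      ≡⟨ cong₂ _+_ (sym (chainSum-expand p (binomial r))) (∑-cong (allSubsets n) above-zeta) ⟩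
    chainSum p (binomial r) + ∑ (allSubsets n) (λ a → when (p ⊊ᵇ a) 1ℤ * zeta r a)
      ≡⟨ cong (λ t → t + ∑ (allSubsets n) (λ a → when (p ⊊ᵇ a) 1ℤ * zeta r a))
           (trans (chainSum-binomial r p Fp) (sym (∑-power-0 p (zeta r)))) ⟩
    ∑ (allSubsets n) (λ a → power 0ℤ p a * zeta r a) + ∑ (allSubsets n) (λ a → when (p ⊊ᵇ a) 1ℤ * zeta r a)
      ≡⟨ ∑-+ (allSubsets n) (λ a → power 0ℤ p a * zeta r a) (λ a → when (p ⊊ᵇ a) 1ℤ * zeta r a) ⟨
    ∑ (allSubsets n) (λ a → power 0ℤ p a * zeta r a + when (p ⊊ᵇ a) 1ℤ * zeta r a)
      ≡⟨ ∑-cong (allSubsets n) (λ a → trans (sym (ℤₚ.*-distribʳ-+ (zeta r a) (power 0ℤ p a) (when (p ⊊ᵇ a) 1ℤ)))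
           (cong (_* zeta r a) (sym (power-1-split p a)))) ⟩
    ∑ (allSubsets n) (λ a → power 1ℤ p a * zeta r a)
      ≡⟨ ∑-cong (allSubsets n) (λ a → trans (sym (∑-*ˡ (allSubsets n) (power 1ℤ p a) _))
           (∑-cong (allSubsets n) λ q → sym (when-* (isFace q) (power 1ℤ p a) (power (+ r) a q)))) ⟩
    ∑ (allSubsets n) (λ a → ∑ (allSubsets n) (λ q → when (isFace q) (power 1ℤ p a * power (+ r) a q)))
      ≡⟨ ∑-comm (allSubsets n) (allSubsets n) _ ⟩
    ∑ (allSubsets n) (λ q → ∑ (allSubsets n) (λ a → when (isFace q) (power 1ℤ p a * power (+ r) a q)))
      ≡⟨ ∑-cong (allSubsets n) (λ q → trans (∑-when (isFace q) (allSubsets n) _)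
           (cong (when (isFace q)) (∑-power-* 1ℤ (+ r) p q))) ⟩
    zeta (suc r) p ∎
    where
    open ≡-Reasoning
    above : (ℕ → ℤ) → Subset n → ℤ
    above G a = when (isFace a) (when (p ⊊ᵇ a) (chainSum a G))
    swap-+ : ∀ a b c → a + (b + c) ≡ a + c + b
    swap-+ = solve-∀
    pascal : ∀ a → above (binomial (suc r) ∘ suc) a ≡ above (binomial r) a + above (binomial r ∘ suc) a
    pascal a = begin
      above (binomial (suc r) ∘ suc) a
        ≡⟨ cong (λ t → when (isFace a) (when (p ⊊ᵇ a) t))
             (trans (cliqueSum-cong-weight comparable L (a ⊊ᵇ_) (binomial-suc r))
                    (cliqueSum-+ comparable L (a ⊊ᵇ_) (binomial r) (binomial r ∘ suc))) ⟩
      when (isFace a) (when (p ⊊ᵇ a) (chainSum a (binomial r) + chainSum a (binomial r ∘ suc)))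
        ≡⟨ cong (when (isFace a)) (when-+ (p ⊊ᵇ a) _ _) ⟩
      when (isFace a) (when (p ⊊ᵇ a) (chainSum a (binomial r)) + when (p ⊊ᵇ a) (chainSum a (binomial r ∘ suc)))
        ≡⟨ when-+ (isFace a) _ _ ⟩
      above (binomial r) a + above (binomial r ∘ suc) a ∎
    above-zeta : ∀ a → above (binomial r) a ≡ when (p ⊊ᵇ a) 1ℤ * zeta r a
    above-zeta a = begin
      above (binomial r) a                               ≡⟨ on-faces ⟩
      when (isFace a) (when (p ⊊ᵇ a) (zeta r a))         ≡⟨ when-swap (isFace a) (p ⊊ᵇ a) (zeta r a) ⟩
      when (p ⊊ᵇ a) (when (isFace a) (zeta r a))         ≡⟨ cong (when (p ⊊ᵇ a)) (zeta-nonface r a) ⟩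
      when (p ⊊ᵇ a) (zeta r a)                           ≡⟨ as-product (p ⊊ᵇ a) ⟩
      when (p ⊊ᵇ a) 1ℤ * zeta r a                        ∎
      where
      on-faces : above (binomial r) a ≡ when (isFace a) (when (p ⊊ᵇ a) (zeta r a))
      on-faces with Face? Δ a
      ... | yes Fa = cong (when (p ⊊ᵇ a)) (chainSum-binomial r a Fa)
      ... | no _   = refl
      as-product : ∀ b → when b (zeta r a) ≡ when b 1ℤ * zeta r a
      as-product true  = sym (ℤₚ.*-identityˡ (zeta r a))
      as-product false = refl

  -- A chain of i faces above `p` ends in a face with at least i + ∣p∣ elements, so weights beyond
  -- that bound never occur.
  chainSum-cong : ∀ d → (∀ p → Face Δ p → ∣ p ∣ ≤ d) → ∀ {G G′} p → Face Δ p →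
                  (∀ i → i ℕ.+ ∣ p ∣ ≤ d → G i ≡ G′ i) → chainSum p G ≡ chainSum p G′
  chainSum-cong d Δ≤d p Fp = go (suc d) p Fp (ℕₚ.m≤n+m (suc d) ∣ p ∣)
    where
    -- Face sizes grow strictly along a chain, so the gap d - ∣p∣ bounds the depth of the recursion.
    go : ∀ fuel {G G′} p → Face Δ p → d ℕ.< ∣ p ∣ ℕ.+ fuel →
         (∀ i → i ℕ.+ ∣ p ∣ ≤ d → G i ≡ G′ i) → chainSum p G ≡ chainSum p G′
    go zero p Fp d<p _ = contradiction (Δ≤d p Fp) (ℕₚ.<⇒≱ (subst (d ℕ.<_) (ℕₚ.+-identityʳ ∣ p ∣) d<p))
    go (suc fuel) {G} {G′} p Fp d<p G≗G′ = begin
      chainSum p G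
        ≡⟨ chainSum-expand p G ⟩
      G 0 + ∑ (allSubsets n) (λ a → when (isFace a) (when (p ⊊ᵇ a) (chainSum a (G ∘ suc))))
        ≡⟨ cong₂ _+_ (G≗G′ 0 (Δ≤d p Fp)) (∑-cong (allSubsets n) step) ⟩
      G′ 0 + ∑ (allSubsets n) (λ a → when (isFace a) (when (p ⊊ᵇ a) (chainSum a (G′ ∘ suc))))
        ≡⟨ chainSum-expand p G′ ⟨
      chainSum p G′ ∎
      where
      open ≡-Reasoning
      step : ∀ a → when (isFace a) (when (p ⊊ᵇ a) (chainSum a (G ∘ suc))) ≡
                   when (isFace a) (when (p ⊊ᵇ a) (chainSum a (G′ ∘ suc)))
      step a with Face? Δ a | p ⊊ᵇ a in p⊊a
      ... | no _   | _     = refl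
      ... | yes _  | false = refl
      ... | yes Fa | true  = go fuel a Fa
            (ℕₚ.<-≤-trans d<p (ℕₚ.≤-trans (ℕₚ.≤-reflexive (ℕₚ.+-suc ∣ p ∣ fuel)) (ℕₚ.+-monoˡ-≤ fuel p<a)))
            (λ i i+a≤d → G≗G′ (suc i) (ℕₚ.≤-trans (ℕₚ.≤-trans (ℕₚ.≤-reflexive (sym (ℕₚ.+-suc i ∣ p ∣))) (ℕₚ.+-monoʳ-≤ i p<a)) i+a≤d))
        where
        p<a : ∣ p ∣ ℕ.< ∣ a ∣
        p<a = ⊊ᵇ-size p a p⊊a

  -- Faces of the subdivision are the cliques of nonempty faces, and these are exactly the faces
  -- strictly above the empty one.
  subdivision-∑ : ∀ G → ∑ (faces (barycentricSubdivision Δ)) (G ∘ ∣_∣) ≡ chainSum ⊥ G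
  subdivision-∑ G = begin
    ∑ (faces (barycentricSubdivision Δ)) (G ∘ ∣_∣)
      ≡⟨ ∑-filter (Face? (barycentricSubdivision Δ)) (allSubsets (length L)) (G ∘ ∣_∣) ⟩
    ∑ (allSubsets (length L)) (λ S → when (does (Face? (barycentricSubdivision Δ) S)) (G ∣ S ∣))
      ≡⟨ ∑-cong (allSubsets (length L)) (λ S → cong (λ b → when b (G ∣ S ∣))
           (clique-does Comparable? (λ p → inj₁ ⊆-refl) swap L S (Face? (barycentricSubdivision Δ) S))) ⟩
    ∑ (allSubsets (length L)) (λ S → when (clique comparable L (const true) S) (G ∣ S ∣))
      ≡⟨ ∑-clique comparable L (const true) G ⟩
    cliqueSum comparable L (const true) G
      ≡⟨ cliqueSum-cong comparable L G (λ {b} b∈L → sym (⊥⊊ b (proj₂ (∈-filter⁻ nonempty? {xs = faces Δ} b∈L)))) ⟩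
    chainSum ⊥ G ∎
    where
    open ≡-Reasoning
    ⊥⊊ : ∀ b → Nonempty b → (⊥ ⊊ᵇ b) ≡ true
    ⊥⊊ b (x , x∈b) = ⊊ᵇ-complete ⊥ b ⊥⊆ (dec-false (b ⊆? ⊥) λ b⊆⊥ → ∉⊥ (b⊆⊥ x∈b))

-- h-vectors of subdivisions

[1-x]^-∇^ : ∀ m → ∇^ m one ≗ [1-x]^ m
[1-x]^-∇^ zero    k = refl
[1-x]^-∇^ (suc m) k = ∇-cong ([1-x]^-∇^ m) k

∇-binomial : ∀ i → [1-x]· (λ r → binomial r (suc i)) ≗ x· (λ r → binomial r i)
∇-binomial i zero    = refl
∇-binomial i (suc r) = trans (cong (_- binomial r (suc i)) (binomial-suc r i)) (lemma (binomial r i) (binomial r (suc i)))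
  where
  lemma : ∀ a b → a + b - b ≡ a
  lemma = solve-∀

-- The series Σ_r C(r, i) x^r is x^i / (1-x)^(i+1). By Pascal's rule one difference lowers i by one
-- and produces a factor x.
∇^-binomial : ∀ d i → i ≤ d → ∀ k → ∇^ (suc d) (λ r → binomial r i) k ≡ hWeight d k i
∇^-binomial d zero _ k = begin
  ∇^ (suc d) (λ _ → 1ℤ) k        ≡⟨ ∇^-suc d (λ _ → 1ℤ) k ⟩
  ∇^ d ([1-x]· (λ _ → 1ℤ)) k     ≡⟨ ∇^-cong d [1-x]·1 k ⟩
  ∇^ d one k                     ≡⟨ [1-x]^-∇^ d k ⟩
  ([1-x]^ d) k                   ∎
  where open ≡-Reasoning
∇^-binomial (suc d) (suc i) (s≤s i≤d) k = begin
  ∇^ (suc (suc d)) (λ r → binomial r (suc i)) k         ≡⟨ ∇^-suc (suc d) (λ r → binomial r (suc i)) k ⟩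
  ∇^ (suc d) ([1-x]· (λ r → binomial r (suc i))) k      ≡⟨ ∇^-cong (suc d) (∇-binomial i) k ⟩
  ∇^ (suc d) (x· (λ r → binomial r i)) k                ≡⟨ ∇^-x· (suc d) (λ r → binomial r i) k ⟩
  (x· ∇^ (suc d) (λ r → binomial r i)) k                ≡⟨ x·-cong (∇^-binomial d i i≤d) k ⟩
  (x· (x^ i · ([1-x]^ (d ∸ i)))) k                      ∎
  where open ≡-Reasoning

hVector-faces : ∀ d (Δ : SimplicialComplex n) → (∀ p → Face Δ p → ∣ p ∣ ≤ d) → ∀ i →
                hVector d Δ i ≡ ∑ (faces Δ) (hWeight d (toℕ i) ∘ ∣_∣)
hVector-faces {n} d Δ Δ≤d i = trans (hVector-∑ d Δ i) (∑-cong-∈ (faces Δ) λ {p} p∈ →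
  truncate-< (hWeight d (toℕ i)) (s≤s (Δ≤d p (proj₂ (∈-filter⁻ (Face? Δ) {xs = allSubsets n} p∈)))))

hVector-subdivision : ∀ d (Δ : SimplicialComplex n) → (∀ p → Face Δ p → ∣ p ∣ ≤ d) → ∀ i →
                      hVector d (barycentricSubdivision Δ) i ≡
                      ∇^ (suc d) (λ r → ∑ (faces Δ) (λ p → (+ r) ℤ.^ ∣ p ∣)) (toℕ i)
hVector-subdivision {n} d Δ Δ≤d i = begin
  hVector d (barycentricSubdivision Δ) i
    ≡⟨ hVector-∑ d (barycentricSubdivision Δ) i ⟩
  ∑ (faces (barycentricSubdivision Δ)) (truncate (suc d) (hWeight d k) ∘ ∣_∣)
    ≡⟨ subdivision-∑ (truncate (suc d) (hWeight d k)) ⟩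
  chainSum ⊥ (truncate (suc d) (hWeight d k))
    ≡⟨ chainSum-cong d Δ≤d ⊥ (∅-face Δ) bounded ⟩
  chainSum ⊥ (λ i → ∇^ (suc d) (λ r → binomial r i) k)
    ≡⟨ cliqueSum-∇^ comparable (suc d) L (⊥ ⊊ᵇ_) (λ i r → binomial r i) k ⟩
  ∇^ (suc d) (λ r → chainSum ⊥ (binomial r)) k
    ≡⟨ ∇^-cong (suc d) (λ r → trans (chainSum-binomial r ⊥ (∅-face Δ)) (zeta-⊥ r)) k ⟩
  ∇^ (suc d) (λ r → ∑ (faces Δ) (λ p → (+ r) ℤ.^ ∣ p ∣)) k ∎
  where
  open ≡-Reasoning
  open Chains Δ
  k = toℕ i
  bounded : ∀ i → i ℕ.+ ∣ ⊥ {n = n} ∣ ≤ d → truncate (suc d) (hWeight d k) i ≡ ∇^ (suc d) (λ r → binomial r i) k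
  bounded i i≤d′ = trans (truncate-< (hWeight d k) (s≤s i≤d)) (sym (∇^-binomial d i i≤d k))
    where
    i≤d : i ≤ d
    i≤d = ℕₚ.≤-trans (ℕₚ.m≤m+n i _) i≤d′
  zeta-⊥ : ∀ r → zeta r ⊥ ≡ ∑ (faces Δ) (λ p → (+ r) ℤ.^ ∣ p ∣)
  zeta-⊥ r = trans (∑-cong (allSubsets n) λ q → cong (when (isFace q)) (power-⊥ (+ r) q))
                   (sym (∑-filter (Face? Δ) (allSubsets n) _))

-- The initial parts of a shelling of the boundary of a simplex: p is a face of
-- the m-th one if it misses one of the vertices 0, …, m.

Misses : ℕ → Subset n → Set
Misses m       []            = Empty.⊥
Misses m       (outside ∷ p) = Unit.⊤
Misses zero    (inside ∷ p)  = Empty.⊥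
Misses (suc m) (inside ∷ p)  = Misses m p

Misses? : ∀ m (p : Subset n) → Dec (Misses m p)
Misses? m       []            = no λ ()
Misses? m       (outside ∷ p) = yes tt
Misses? zero    (inside ∷ p)  = no λ ()
Misses? (suc m) (inside ∷ p)  = Misses? m p

Misses-⊆ : ∀ m {p q : Subset n} → p ⊆ q → Misses m q → Misses m p
Misses-⊆ m       {outside ∷ p} {y ∷ q}       p⊆q mq = tt
Misses-⊆ m       {inside ∷ p}  {outside ∷ q} p⊆q mq = case p⊆q here of λ ()
Misses-⊆ (suc m) {inside ∷ p}  {inside ∷ q}  p⊆q mq = Misses-⊆ m (drop-∷-⊆ p⊆q) mq

Misses-size : ∀ m (p : Subset (suc n)) → Misses m p → ∣ p ∣ ≤ n
Misses-size         m       (outside ∷ p) mp = ∣p∣≤n p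
Misses-size {zero}  (suc m) (inside ∷ []) ()
Misses-size {suc n} (suc m) (inside ∷ p)  mp = s≤s (Misses-size m p mp)

shelled : ∀ d → ℕ → SimplicialComplex (suc d)
shelled d m = record { Face = Misses m ; Face? = Misses? m ; ∅-face = tt ; ⊆-face = Misses-⊆ m }

shelled-dimension : ∀ d m → HasDimension (shelled (suc d) m) d
-- The facet opposite vertex 0 belongs to every stage of the shelling.
shelled-dimension d m = (outside ∷ ⊤ , tt , ∣⊤∣≡n (suc d)) , Misses-size m

sizeSum : ∀ n → (ℕ → ℤ) → ℤ
sizeSum n φ = ∑ (allSubsets n) (φ ∘ ∣_∣)

sizeSum-suc : ∀ n φ → sizeSum (suc n) φ ≡ sizeSum n φ + sizeSum n (φ ∘ suc)
sizeSum-suc n φ = ∑-allSubsets {n} (φ ∘ ∣_∣)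

-- The weight is left free: `hWeight` gives the h-polynomial, and powers of r give the multichain
-- counts.
missSum : ℕ → ∀ n → (ℕ → ℤ) → ℤ
missSum m n φ = ∑ (allSubsets n) (λ p → when (does (Misses? m p)) (φ ∣ p ∣))

missSum-zero : ∀ n φ → missSum 0 (suc n) φ ≡ sizeSum n φ
missSum-zero n φ = trans (∑-allSubsets {n} (λ p → when (does (Misses? 0 p)) (φ ∣ p ∣)))
  (trans (cong (λ t → sizeSum n φ + t) (∑-zero (allSubsets n))) (ℤₚ.+-identityʳ (sizeSum n φ)))

missSum-suc : ∀ m n φ → missSum (suc m) (suc n) φ ≡ sizeSum n φ + missSum m n (φ ∘ suc)
missSum-suc m n φ = ∑-allSubsets {n} (λ p → when (does (Misses? (suc m) p)) (φ ∣ p ∣))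

-- The new faces contain the vertices 0, ..., m, miss m + 1, and are arbitrary on the other n - m -
-- 1 vertices.
missSum-step : ∀ m n φ → m ℕ.< n →
               missSum (suc m) (suc n) φ ≡ missSum m (suc n) φ + sizeSum (n ∸ suc m) (φ ∘ (suc m ℕ.+_))
missSum-step zero    (suc n) φ _         = trans (missSum-suc 0 (suc n) φ)
  (cong₂ _+_ (sym (missSum-zero (suc n) φ)) (missSum-zero n (φ ∘ suc)))
missSum-step (suc m) (suc n) φ (s≤s m<n) = begin
  missSum (suc (suc m)) (suc (suc n)) φ
    ≡⟨ missSum-suc (suc m) (suc n) φ ⟩
  sizeSum (suc n) φ + missSum (suc m) (suc n) (φ ∘ suc)
    ≡⟨ cong (λ t → sizeSum (suc n) φ + t) (missSum-step m n (φ ∘ suc) m<n) ⟩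
  sizeSum (suc n) φ + (missSum m (suc n) (φ ∘ suc) + new)
    ≡⟨ ℤₚ.+-assoc (sizeSum (suc n) φ) (missSum m (suc n) (φ ∘ suc)) new ⟨
  sizeSum (suc n) φ + missSum m (suc n) (φ ∘ suc) + new
    ≡⟨ cong (λ t → t + new) (missSum-suc m (suc n) φ) ⟨
  missSum (suc m) (suc (suc n)) φ + new ∎
  where
  open ≡-Reasoning
  new = sizeSum (n ∸ suc m) (φ ∘ (suc (suc m) ℕ.+_))

-- The binomial theorem for (t + 1)^n, with t^c factored out.
sizeSum-power : ∀ n c t → sizeSum n (λ i → t ℤ.^ (c ℕ.+ i)) ≡ (t + 1ℤ) ℤ.^ n * t ℤ.^ c
sizeSum-power zero    c t rewrite ℕₚ.+-identityʳ c = lemma (t ℤ.^ c)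
  where
  lemma : ∀ x → x + 0ℤ ≡ 1ℤ * x
  lemma = solve-∀
sizeSum-power (suc n) c t = begin
  sizeSum (suc n) (λ i → t ℤ.^ (c ℕ.+ i))
    ≡⟨ sizeSum-suc n (λ i → t ℤ.^ (c ℕ.+ i)) ⟩
  sizeSum n (λ i → t ℤ.^ (c ℕ.+ i)) + sizeSum n (λ i → t ℤ.^ (c ℕ.+ suc i))
    ≡⟨ cong₂ _+_ (sizeSum-power n c t)
         (trans (∑-cong (allSubsets n) λ p → cong (t ℤ.^_) (ℕₚ.+-suc c ∣ p ∣)) (sizeSum-power n (suc c) t)) ⟩
  (t + 1ℤ) ℤ.^ n * t ℤ.^ c + (t + 1ℤ) ℤ.^ n * (t * t ℤ.^ c)
    ≡⟨ lemma t ((t + 1ℤ) ℤ.^ n) (t ℤ.^ c) ⟩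
  (t + 1ℤ) ℤ.^ suc n * t ℤ.^ c ∎
  where
  open ≡-Reasoning
  lemma : ∀ t P x → P * x + P * (t * x) ≡ (t + 1ℤ) * P * x
  lemma = solve-∀

x^-[1-x]· : ∀ j g k → (x^ j · ([1-x]· g)) k ≡ (x^ j · g) k - (x^ suc j · g) k
x^-[1-x]· zero    g k       = refl
x^-[1-x]· (suc j) g zero    = refl
x^-[1-x]· (suc j) g (suc k) = x^-[1-x]· j g k

-- The binomial theorem for (x + (1-x))^n = 1, multiplied by x^c.
sizeSum-[1-x]^ : ∀ n c k → sizeSum n (λ i → (x^ (c ℕ.+ i) · ([1-x]^ (n ∸ i))) k) ≡ (x^ c · one) k
sizeSum-[1-x]^ zero    c k rewrite ℕₚ.+-identityʳ c = ℤₚ.+-identityʳ _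
sizeSum-[1-x]^ (suc n) c k = begin
  sizeSum (suc n) (λ i → (x^ (c ℕ.+ i) · ([1-x]^ (suc n ∸ i))) k)
    ≡⟨ sizeSum-suc n (λ i → (x^ (c ℕ.+ i) · ([1-x]^ (suc n ∸ i))) k) ⟩
  sizeSum n (λ i → (x^ (c ℕ.+ i) · ([1-x]^ (suc n ∸ i))) k) + sizeSum n (λ i → (x^ (c ℕ.+ suc i) · ([1-x]^ (n ∸ i))) k)
    ≡⟨ cong₂ _+_ (∑-cong (allSubsets n) λ p → split ∣ p ∣ (∣p∣≤n p)) (∑-cong (allSubsets n) λ p → shift ∣ p ∣) ⟩
  ∑ (allSubsets n) (λ p → u c ∣ p ∣ - u (suc c) ∣ p ∣) + sizeSum n (u (suc c))
    ≡⟨ ∑-+ (allSubsets n) (λ p → u c ∣ p ∣ - u (suc c) ∣ p ∣) (u (suc c) ∘ ∣_∣) ⟨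
  ∑ (allSubsets n) (λ p → (u c ∣ p ∣ - u (suc c) ∣ p ∣) + (u (suc c) ∣ p ∣))
    ≡⟨ ∑-cong (allSubsets n) (λ p → lemma (u c ∣ p ∣) (u (suc c) ∣ p ∣)) ⟩
  sizeSum n (u c)
    ≡⟨ sizeSum-[1-x]^ n c k ⟩
  (x^ c · one) k ∎
  where
  open ≡-Reasoning
  u : ℕ → ℕ → ℤ
  u c i = (x^ (c ℕ.+ i) · ([1-x]^ (n ∸ i))) k
  lemma : ∀ a b → a - b + b ≡ a
  lemma = solve-∀
  split : ∀ i → i ≤ n → (x^ (c ℕ.+ i) · ([1-x]^ (suc n ∸ i))) k ≡ u c i - u (suc c) i
  split i i≤n rewrite ℕₚ.+-∸-assoc 1 i≤n = x^-[1-x]· (c ℕ.+ i) ([1-x]^ (n ∸ i)) k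
  shift : ∀ i → (x^ (c ℕ.+ suc i) · ([1-x]^ (n ∸ i))) k ≡ u (suc c) i
  shift i rewrite ℕₚ.+-suc c i = refl

missSum-[1-x]^ : ∀ m d k → m ℕ.< d →
  missSum (suc m) (suc d) (hWeight d k) ≡ missSum m (suc d) (hWeight d k) + (x^ suc m · one) k
missSum-[1-x]^ m d k m<d = trans (missSum-step m d (hWeight d k) m<d)
  (cong (λ t → missSum m (suc d) (hWeight d k) + t)
    (trans (∑-cong (allSubsets (d ∸ suc m)) λ p → cong (λ e → (x^ (suc m ℕ.+ ∣ p ∣) · ([1-x]^ e)) k) (sym (ℕₚ.∸-+-assoc d (suc m) ∣ p ∣)))
           (sizeSum-[1-x]^ (d ∸ suc m) (suc m) k)))

-- The columns of the transformation matrix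

sum-monomial : ∀ {m} (f : Fin m → ℤ) j → sum {m} (λ l → f l * (x^ toℕ j · one) (toℕ l)) ≡ f j
sum-monomial {suc m} f zero    = trans
  (cong (λ t → f zero * 1ℤ + t) (sum-zero {m} _ λ l → ℤₚ.*-zeroʳ (f (suc l)))) (lemma (f zero))
  where
  lemma : ∀ x → x * 1ℤ + 0ℤ ≡ x
  lemma = solve-∀
sum-monomial {suc m} f (suc j) = trans
  (cong₂ _+_ (ℤₚ.*-zeroʳ (f zero)) (sum-monomial (f ∘ suc) j)) (ℤₚ.+-identityˡ (f (suc j)))

-- Consecutive shelling stages have h-vectors that differ by a unit vector, so the difference of the
-- h-vectors of their subdivisions is a column of `H`.
transformationMatrix-column : ∀ e (H : Matrix (suc (suc e)) (suc (suc e))) → IsTransformationMatrix (suc e) H →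
                              ∀ i j → H i j ≡ subdivisionColumn (suc e) (toℕ j) (toℕ i)
transformationMatrix-column e H isH i j = trans (sym (sum-monomial (H i) j)) (column j)
  where
  open ≡-Reasoning
  d = suc e

  -- Row `i` of `H` as a linear functional on coefficient sequences.
  apply : Polynomial → ℤ
  apply g = sum {suc d} (λ l → H i l * g (toℕ l))

  apply-cong : ∀ {g h} → g ≗ h → apply g ≡ apply h
  apply-cong g≗h = sum-cong-≗ {suc d} λ l → cong (H i l *_) (g≗h (toℕ l))

  apply-+ : ∀ g h → apply (λ k → g k + h k) ≡ apply g + apply h
  apply-+ g h = trans (sum-cong-≗ {suc d} λ l → ℤₚ.*-distribˡ-+ (H i l) (g (toℕ l)) (h (toℕ l)))
                      (∑-distrib-+ {suc d} (λ l → H i l * g (toℕ l)) (λ l → H i l * h (toℕ l)))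

  hPoly : ℕ → Polynomial
  hPoly m k = missSum m (suc d) (hWeight d k)

  fPoly : ℕ → Polynomial
  fPoly m r = missSum m (suc d) ((+ r) ℤ.^_)

  transform : ∀ m → apply (hPoly m) ≡ ∇^ (suc d) (fPoly m) (toℕ i)
  transform m = begin
    apply (hPoly m)
      ≡⟨ sum-cong-≗ {suc d} (λ l → cong (H i l *_) (sym (trans
           (hVector-faces d (shelled d m) (Misses-size m) l) (∑-filter (Misses? m) (allSubsets (suc d)) (hWeight d (toℕ l) ∘ ∣_∣))))) ⟩
    (H *ᵥ hVector d (shelled d m)) i
      ≡⟨ isH (shelled d m) (shelled-dimension e m) i ⟨
    hVector d (barycentricSubdivision (shelled d m)) i
      ≡⟨ hVector-subdivision d (shelled d m) (Misses-size m) i ⟩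
    ∇^ (suc d) (λ r → ∑ (faces (shelled d m)) (λ p → (+ r) ℤ.^ ∣ p ∣)) (toℕ i)
      ≡⟨ ∇^-cong (suc d) (λ r → ∑-filter (Misses? m) (allSubsets (suc d)) (λ p → (+ r) ℤ.^ ∣ p ∣)) (toℕ i) ⟩
    ∇^ (suc d) (fPoly m) (toℕ i) ∎

  column : ∀ j → apply (x^ toℕ j · one) ≡ subdivisionColumn d (toℕ j) (toℕ i)
  column zero = begin
    apply one                       ≡⟨ apply-cong (λ k → trans (sym (sizeSum-[1-x]^ d 0 k)) (sym (missSum-zero d (hWeight d k)))) ⟩
    apply (hPoly 0)                 ≡⟨ transform 0 ⟩
    ∇^ (suc d) (fPoly 0) (toℕ i)    ≡⟨ ∇^-cong (suc d) (λ r → trans (missSum-zero d ((+ r) ℤ.^_)) (sizeSum-power d 0 (+ r))) (toℕ i) ⟩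
    subdivisionColumn d 0 (toℕ i)   ∎
  -- Both sides are completed by the contribution of stage m, which turns the unit vector into the
  -- h-vector of stage m + 1.
  column (suc j′) = ∙-cancelˡ (apply (hPoly (toℕ j′))) _ _ (begin
    apply (hPoly m) + apply (x^ suc m · one)
      ≡⟨ apply-+ (hPoly m) (x^ suc m · one) ⟨
    apply (λ k → hPoly m k + (x^ suc m · one) k)
      ≡⟨ apply-cong (λ k → sym (missSum-[1-x]^ m d k m<d)) ⟩
    apply (hPoly (suc m))
      ≡⟨ transform (suc m) ⟩
    ∇^ (suc d) (fPoly (suc m)) (toℕ i)
      ≡⟨ ∇^-cong (suc d) (λ r → trans (missSum-step m d ((+ r) ℤ.^_) m<d)
           (cong (λ t → fPoly m r + t) (sizeSum-power (d ∸ suc m) (suc m) (+ r)))) (toℕ i) ⟩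
    ∇^ (suc d) (λ r → fPoly m r + (+ r + 1ℤ) ℤ.^ (d ∸ suc m) * (+ r) ℤ.^ suc m) (toℕ i)
      ≡⟨ ∇^-+ (suc d) (fPoly m) (λ r → (+ r + 1ℤ) ℤ.^ (d ∸ suc m) * (+ r) ℤ.^ suc m) (toℕ i) ⟩
    ∇^ (suc d) (fPoly m) (toℕ i) + subdivisionColumn d (suc m) (toℕ i)
      ≡⟨ cong (λ t → t + subdivisionColumn d (suc m) (toℕ i)) (transform m) ⟨
    apply (hPoly m) + subdivisionColumn d (suc m) (toℕ i) ∎)
    where
    m = toℕ j′
    m<d : m ℕ.< d
    m<d = Finₚ.toℕ<n j′

corollary3p3 : (d : ℕ) → 1 ≤ d → (H : Matrix (suc d) (suc d)) →
    IsTransformationMatrix d H → TotallyPositive H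
corollary3p3 (suc e) _ H isH k r c r↑ c↑ =
  subst (0ℤ ℤ.≤_) (det-cong λ i j → sym (transformationMatrix-column e H isH (r i) (c j)))
    (subdivisionColumn-minors (suc e) k (toℕ ∘ r) (toℕ ∘ c) r↑ c↑ (λ j → Finₚ.toℕ≤pred[n] (c j)))
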